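{- Let $a$ and $b$ be positive integers with $\gcd(a,b)=1$, let $\lambda\in\mathbb{C}$ with $\lambda\neq 0$, $\lambda^a=1$ and $\lambda^b\neq 1$, and let $m$ be a nonnegative integer. Then \begin{align*} S_m^{(\lambda)}(a,b)&=\sum_{\ell=0}^{m+1}\sum_{i=0}^\ell\binom{m+1}{\ell}\binom{\ell}{i}\frac{a^{m-\ell+i+1}b^{m-i+1}}{(m-\ell+2)(m+1)\lambda}B_i\,\mathcal B_{\ell-i}(\lambda^b)\\ &\quad -\frac{\mathcal B_{m+1}(\lambda)}{(m+1)\lambda}. \end{align*}
   Context: For coprime positive integers $a,b$, $\mathrm{NR}(a,b)$ denotes the (finite) set of all nonnegative integers $n$ that cannot be expressed in the form $n=ax+by$ with $x,y$ nonnegative integers. (Since $0$ is representable, all elements are positive.) For a nonnegative integer $m$ and $\lambda\neq 0$, $$S_m^{(\lambda)}(a,b):=\sum_{n\in \mathrm{NR}(a,b)}\lambda^{n-1}n^m.$$ For a complex number $\mu\neq 1$, the Apostol-Bernoulli numbers $\mathcal B_n(\mu)$ ($n\ge 0$) are defined by the power series expansion at $z=0$ $$\frac{z}{\mu e^z-1}=\sum_{n=0}^\infty \mathcal B_n(\mu)\frac{z^n}{n!}.$$ For example, $\mathcal B_0(\mu)=0$, $\mathcal B_1(\mu)=\frac{1}{\mu-1}$, $\mathcal B_2(\mu)=-\frac{2\mu}{(\mu-1)^2}$. The $B_n$ are the classical Bernoulli numbers, defined by $\frac{z}{e^z-1}=\sum_{n=0}^\infty B_n\frac{z^n}{n!}$,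 so $B_0=1$, $B_1=-\frac12$, $B_2=\frac16$. -}

module Defs where

open import Level using (0ℓ; _⊔_)
open import Data.Fin.Base as Fin using (Fin; toℕ)
open import Data.Integer.Base using (+_)
open import Data.List.Base using (List; upTo; filter; map; foldr)
open import Data.List.Membership.Propositional using (_∈_)
open import Data.List.Membership.Propositional.Properties using (∈-filter⁺; ∈-filter⁻; ∈-upTo⁺)
open import Data.List.Relation.Unary.Unique.Propositional using (Unique)
open import Data.List.Relation.Unary.Unique.Propositional.Properties using (upTo⁺; filter⁺)
open import Data.Nat.Base as ℕ using (ℕ; zero; suc; _∸_; _!)
import Data.Nat.Properties as ℕₚ
open import Data.Nat.Coprimality using (coprime-Bézout; gcd≡1⇒coprime)
open import Data.Nat.DivMod using (m≡m%n+[m/n]*n; m%n<n)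
open import Data.Nat.GCD using (gcd; module Bézout)
open import Data.Nat.Properties using (_!≢0)
open import Data.Nat.Solver using () renaming (module +-*-Solver to ℕ-Solver)
open import Data.Product.Base using (∃-syntax; _×_; _,_; proj₁; proj₂)
open import Data.Rational.Base as ℚ using (ℚ; 0ℚ; 1ℚ; ½; ∣_∣; _<_; _≤_)
import Data.Rational.Properties as ℚₚ
open import Data.Rational.Solver using (module +-*-Solver)
open import Data.Sum.Base as Sum using (_⊎_; inj₁; inj₂; [_,_]′)
open import Data.Vec.Base using (Vec; []; _∷_; lookup)
open import Function.Bundles using (_⇔_; mk⇔)
open import Relation.Binary.PropositionalEquality as ≡ using (_≡_)
open import Relation.Nullary using (¬_; Dec; yes; no; contradiction; ¬?)
open import Relation.Nullary.Decidable using (map′)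
open import Algebra.Apartness.Bundles using (HeytingField; HeytingCommutativeRing)
open import Algebra.Bundles using (CommutativeRing)
open import Algebra.Structures using (IsCommutativeRing)
import Algebra.Apartness.Properties.HeytingCommutativeRing as HeytingProperties
import Algebra.Properties.CommutativeSemiring.Exp as Exp
import Algebra.Properties.Monoid.Mult as Mult
import Algebra.Properties.Monoid.Sum as MonoidSum
import Algebra.Properties.Ring as RingProperties
import Algebra.Solver.Ring.NaturalCoefficients.Default as NaturalSolver
import Relation.Binary.Reasoning.Setoid as SetoidReasoning

module NumericalSemigroup where

  Representable : ℕ → ℕ → ℕ → Set
  Representable a b n = ∃[ x ] ∃[ y ] n ≡ a ℕ.* x ℕ.+ b ℕ.* y

  representable? : ∀ a b .{{_ : ℕ.NonZero a}} .{{_ : ℕ.NonZero b}} n → Dec (Representable a b n)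
  representable? a b n = map′
    (λ { (x , _ , y , _ , eq) → x , y , eq })
    (λ { (x , y , eq) → x , x≤n x y eq , y , y≤n x y eq , eq })
    (ℕₚ.anyUpTo? (λ x → ℕₚ.anyUpTo? (λ y → n ℕₚ.≟ a ℕ.* x ℕ.+ b ℕ.* y) (suc n)) (suc n))
    where
    x≤n : ∀ x y → n ≡ a ℕ.* x ℕ.+ b ℕ.* y → x ℕ.< suc n
    x≤n x y ≡.refl = ℕ.s≤s (ℕₚ.≤-trans (ℕₚ.m≤n*m x a) (ℕₚ.m≤m+n (a ℕ.* x) (b ℕ.* y)))
    y≤n : ∀ x y → n ≡ a ℕ.* x ℕ.+ b ℕ.* y → y ℕ.< suc n
    y≤n x y ≡.refl = ℕ.s≤s (ℕₚ.≤-trans (ℕₚ.m≤n*m y b) (ℕₚ.m≤n+m (b ℕ.* y) (a ℕ.* x)))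

  -- For coprime a and b, everything from a * b onwards is representable, so
  -- this finite list contains all nonrepresentable numbers: see ∈-NR.
  NR : ∀ a b .{{_ : ℕ.NonZero a}} .{{_ : ℕ.NonZero b}} → List ℕ
  NR a b = filter (λ n → ¬? (representable? a b n)) (upTo (a ℕ.* b))

  private
    ≥a*b⇒representable : ∀ a b .{{_ : ℕ.NonZero a}} .{{_ : ℕ.NonZero b}} x y →
      1 ℕ.+ y ℕ.* b ≡ x ℕ.* a → ∀ {n} → a ℕ.* b ℕ.≤ n → Representable a b n
    ≥a*b⇒representable a b x y eq {n} ab≤n = r , a ℕ.* q ∸ n ℕ.* y , (begin-equality
      n                                                      ≡⟨ ℕₚ.m+n∸n≡m n (n ℕ.* y ℕ.* b) ⟨
      n ℕ.+ n ℕ.* y ℕ.* b ∸ n ℕ.* y ℕ.* b                    ≡⟨ ≡.cong (_∸ n ℕ.* y ℕ.* b) key ⟩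
      a ℕ.* r ℕ.+ a ℕ.* q ℕ.* b ∸ n ℕ.* y ℕ.* b              ≡⟨ ℕₚ.+-∸-assoc (a ℕ.* r) (ℕₚ.*-monoˡ-≤ b ny≤aq) ⟩
      a ℕ.* r ℕ.+ (a ℕ.* q ℕ.* b ∸ n ℕ.* y ℕ.* b)            ≡⟨ ≡.cong (a ℕ.* r ℕ.+_) (ℕₚ.*-distribʳ-∸ b (a ℕ.* q) (n ℕ.* y)) ⟨
      a ℕ.* r ℕ.+ (a ℕ.* q ∸ n ℕ.* y) ℕ.* b                  ≡⟨ ≡.cong (a ℕ.* r ℕ.+_) (ℕₚ.*-comm (a ℕ.* q ∸ n ℕ.* y) b) ⟩
      a ℕ.* r ℕ.+ b ℕ.* (a ℕ.* q ∸ n ℕ.* y)                  ∎)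
      where
      open ℕₚ.≤-Reasoning
      q = (n ℕ.* x) ℕ./ b
      r = (n ℕ.* x) ℕ.% b
      key : n ℕ.+ n ℕ.* y ℕ.* b ≡ a ℕ.* r ℕ.+ a ℕ.* q ℕ.* b
      key = begin-equality
        n ℕ.+ n ℕ.* y ℕ.* b            ≡⟨ solve 3 (λ n y b → n :+ n :* y :* b := n :* (con 1 :+ y :* b)) ≡.refl n y b ⟩
        n ℕ.* (1 ℕ.+ y ℕ.* b)          ≡⟨ ≡.cong (n ℕ.*_) eq ⟩
        n ℕ.* (x ℕ.* a)                ≡⟨ solve 3 (λ n x a → n :* (x :* a) := a :* (n :* x)) ≡.refl n x a ⟩
        a ℕ.* (n ℕ.* x)                ≡⟨ ≡.cong (a ℕ.*_) (m≡m%n+[m/n]*n (n ℕ.* x) b) ⟩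
        a ℕ.* (r ℕ.+ q ℕ.* b)          ≡⟨ solve 4 (λ a r q b → a :* (r :+ q :* b) := a :* r :+ a :* q :* b) ≡.refl a r q b ⟩
        a ℕ.* r ℕ.+ a ℕ.* q ℕ.* b      ∎
        where open ℕ-Solver
      ar≤n : a ℕ.* r ℕ.≤ n
      ar≤n = ℕₚ.≤-trans (ℕₚ.*-monoʳ-≤ a (ℕₚ.<⇒≤ (m%n<n (n ℕ.* x) b))) ab≤n
      ny≤aq : n ℕ.* y ℕ.≤ a ℕ.* q
      ny≤aq = ℕₚ.*-cancelʳ-≤ (n ℕ.* y) (a ℕ.* q) b (ℕₚ.+-cancelˡ-≤ (a ℕ.* r) _ _ (begin
        a ℕ.* r ℕ.+ n ℕ.* y ℕ.* b      ≤⟨ ℕₚ.+-monoˡ-≤ (n ℕ.* y ℕ.* b) ar≤n ⟩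
        n ℕ.+ n ℕ.* y ℕ.* b            ≡⟨ key ⟩
        a ℕ.* r ℕ.+ a ℕ.* q ℕ.* b      ∎))

    swap : ∀ {a b n} → Representable a b n → Representable b a n
    swap {a} {b} (x , y , eq) = y , x , ≡.trans eq (ℕₚ.+-comm (a ℕ.* x) (b ℕ.* y))

  module _ (a b : ℕ) .{{_ : ℕ.NonZero a}} .{{_ : ℕ.NonZero b}} where

    nonrepresentable⇒<a*b : gcd a b ≡ 1 → ∀ {n} → ¬ Representable a b n → n ℕ.< a ℕ.* b
    nonrepresentable⇒<a*b gcd≡1 {n} ¬rep with n ℕₚ.<? a ℕ.* b
    ... | yes n<ab = n<ab
    ... | no  n≮ab with coprime-Bézout (gcd≡1⇒coprime gcd≡1)
    ...   | Bézout.+- x y eq = contradiction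
            (≥a*b⇒representable a b x y eq (ℕₚ.≮⇒≥ n≮ab)) ¬rep
    ...   | Bézout.-+ x y eq = contradiction
            (swap {b} {a} (≥a*b⇒representable b a y x eq
              (ℕₚ.≤-trans (ℕₚ.≤-reflexive (ℕₚ.*-comm b a)) (ℕₚ.≮⇒≥ n≮ab)))) ¬rep

    ∈-NR : gcd a b ≡ 1 → ∀ n → n ∈ NR a b ⇔ (¬ Representable a b n)
    ∈-NR gcd≡1 n = mk⇔
      (λ n∈NR → proj₂ (∈-filter⁻ (λ n → ¬? (representable? a b n)) {xs = upTo (a ℕ.* b)} n∈NR))
      (λ ¬rep → ∈-filter⁺ (λ n → ¬? (representable? a b n))
                  (∈-upTo⁺ (nonrepresentable⇒<a*b gcd≡1 ¬rep)) ¬rep)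

    NR-unique : Unique (NR a b)
    NR-unique = filter⁺ (λ n → ¬? (representable? a b n)) (upTo⁺ (a ℕ.* b))

module FieldProperties {c ℓ₁ ℓ₂} (F : HeytingField c ℓ₁ ℓ₂) where

  open HeytingField F
  open HeytingCommutativeRing heytingCommutativeRing using (commutativeRing)
  open CommutativeRing commutativeRing using (ring; +-monoid)
  open Mult +-monoid public using () renaming (_×_ to _·_)
  open HeytingProperties heytingCommutativeRing
  open SetoidReasoning setoid

  Characteristic0 : Set ℓ₂
  Characteristic0 = ∀ n → suc n · 1# # 0#

  SumOfSquares#0 : Set (c ⊔ ℓ₂)
  SumOfSquares#0 = ∀ x y → x # 0# → x * x + y * y # 0#

  opaque
    #0⇒inverse : ∀ {x} → x # 0# → ∃[ y ] (x * y ≈ 1#)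
    #0⇒inverse {x} x#0 with #⇒invertible x#0
    ... | y , _ , eq = y , trans (*-congʳ (sym (x-0≈x x))) eq

  inverse : (x : Carrier) → x # 0# → Carrier
  inverse x x#0 = proj₁ (#0⇒inverse x#0)

  inverseʳ : ∀ x (x#0 : x # 0#) → x * inverse x x#0 ≈ 1#
  inverseʳ x x#0 = proj₂ (#0⇒inverse x#0)

  inverse⇒#0 : ∀ {x y} → x * y ≈ 1# → x # 0#
  inverse⇒#0 {x} {y} eq = invertibleʳ⇒# (y , trans (*-congʳ (x-0≈x x)) eq)

  -#0⇒# : ∀ {x y} → x - y # 0# → x # y
  -#0⇒# x-y#0 = invertibleʳ⇒# (#0⇒inverse x-y#0)

  #⇒-#0 : ∀ {x y} → x # y → x - y # 0#
  #⇒-#0 x#y with #⇒invertible x#y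
  ... | z , _ , eq = inverse⇒#0 eq

  *-#0ˡ : ∀ {x y} → x * y # 0# → x # 0#
  *-#0ˡ {x} {y} xy#0 = inverse⇒#0
    (trans (sym (*-assoc x y _)) (inverseʳ (x * y) xy#0))

  *-#0ʳ : ∀ {x y} → x * y # 0# → y # 0#
  *-#0ʳ {x} {y} xy#0 = *-#0ˡ (#-congʳ (*-comm x y) xy#0)

  +-#0 : ∀ {x y} → x + y # 0# → x # 0# ⊎ y # 0#
  +-#0 {x} {y} x+y#0 with #-cotrans x+y#0 y
  ... | inj₁ x+y#y = inj₁ (#-congʳ eq (#⇒-#0 x+y#y))
    where
    eq : x + y - y ≈ x
    eq = trans (+-assoc x y (- y)) (trans (+-congˡ (-‿inverseʳ y)) (+-identityʳ x))
  ... | inj₂ y#0   = inj₂ y#0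

  -x#0⇒x#0 : ∀ {x} → - x # 0# → x # 0#
  -x#0⇒x#0 {x} -x#0 = *-#0ʳ (#-congʳ (sym (-1*x≈-x x)) -x#0)
    where open RingProperties ring

module RealNumbers where

  -- Cauchy sequences of rationals; real numbers up to the equality _≈_ below.
  record ℝ : Set where
    field
      seq      : ℕ → ℚ
      isCauchy : ∀ ε → 0ℚ < ε → ∃[ N ] ∀ {m n} → N ℕ.≤ m → N ℕ.≤ n →
                 ∣ seq m ℚ.- seq n ∣ < ε

  open ℝ public

  infix 4 _≈_ _#_

  record _≈_ (x y : ℝ) : Set where
    constructor mk≈
    field
      close : ∀ ε → 0ℚ < ε → ∃[ N ] ∀ {n} → N ℕ.≤ n → ∣ seq x n ℚ.- seq y n ∣ < ε

  record _#_ (x y : ℝ) : Set where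
    constructor mk#
    field
      gap     : ℚ
      gap>0   : 0ℚ < gap
      from    : ℕ
      distant : ∀ {n} → from ℕ.≤ n → gap ≤ ∣ seq x n ℚ.- seq y n ∣

  open _≈_
  open _#_

  private
    Small Bounded : (ℕ → ℕ → ℚ) → Set
    Small f = ∀ ε → 0ℚ < ε → ∃[ N ] ∀ {m n} → N ℕ.≤ m → N ℕ.≤ n → ∣ f m n ∣ < ε
    Bounded f = ∃[ M ] 0ℚ < M × ∃[ N ] (∀ {m n} → N ℕ.≤ m → N ℕ.≤ n → ∣ f m n ∣ ≤ M)

    opaque
      *-pos : ∀ {p q} → 0ℚ < p → 0ℚ < q → 0ℚ < p ℚ.* q
      *-pos {p} {q} 0<p 0<q = ≡.subst (_< p ℚ.* q) (ℚₚ.*-zeroʳ p)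
        (ℚₚ.*-monoʳ-<-pos p {{ℚ.positive 0<p}} 0<q)

    nonZero : ∀ {p} → 0ℚ < p → ℚ.NonZero p
    nonZero {p} 0<p = ℚₚ.pos⇒nonZero p {{ℚ.positive 0<p}}

    recip : ℚ → ℚ
    recip q with q ℚₚ.≟ 0ℚ
    ... | yes _   = 0ℚ
    ... | no  q≢0 = ℚ.1/_ q {{ℚ.≢-nonZero q≢0}}

    recip-inverse : ∀ q → ¬ q ≡ 0ℚ → q ℚ.* recip q ≡ 1ℚ
    recip-inverse q q≢0 with q ℚₚ.≟ 0ℚ
    ... | yes q≡0 = contradiction q≡0 q≢0
    ... | no  q≢0 = ℚₚ.*-inverseʳ q {{ℚ.≢-nonZero q≢0}}

    >0⇒≢0 : ∀ {p} → 0ℚ < p → ¬ p ≡ 0ℚ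
    >0⇒≢0 0<p p≡0 = ℚₚ.<⇒≢ 0<p (≡.sym p≡0)

    recip-pos : ∀ {p} → 0ℚ < p → 0ℚ < recip p
    recip-pos {p} 0<p with p ℚₚ.≟ 0ℚ
    ... | yes p≡0 = contradiction p≡0 (>0⇒≢0 0<p)
    ... | no  p≢0 = ℚₚ.positive⁻¹ _ {{ℚₚ.1/pos⇒pos p {{ℚ.positive 0<p}}}}

    opaque
      half third : ℚ → ℚ
      half ε = ½ ℚ.* ε
      third ε = + 1 ℚ./ 3 ℚ.* ε

      half>0 : ∀ {ε} → 0ℚ < ε → 0ℚ < half ε
      half>0 = *-pos (ℚₚ.positive⁻¹ ½)

      third>0 : ∀ {ε} → 0ℚ < ε → 0ℚ < third ε
      third>0 = *-pos (ℚₚ.positive⁻¹ (+ 1 ℚ./ 3))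

      half+half : ∀ ε → half ε ℚ.+ half ε ≡ ε
      half+half ε = ≡.trans (≡.sym (ℚₚ.*-distribʳ-+ ε ½ ½)) (ℚₚ.*-identityˡ ε)

      third+third+third : ∀ ε → third ε ℚ.+ third ε ℚ.+ third ε ≡ ε
      third+third+third ε = ≡.trans
        (≡.cong (ℚ._+ third ε) (≡.sym (ℚₚ.*-distribʳ-+ ε (+ 1 ℚ./ 3) (+ 1 ℚ./ 3))))
        (≡.trans (≡.sym (ℚₚ.*-distribʳ-+ ε (+ 1 ℚ./ 3 ℚ.+ + 1 ℚ./ 3) (+ 1 ℚ./ 3))) (ℚₚ.*-identityˡ ε))

    open ℚₚ.≤-Reasoning

    later₁ : ∀ {M N n} → M ℕ.⊔ N ℕ.≤ n → M ℕ.≤ n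
    later₁ {M} {N} = ℕₚ.m⊔n≤o⇒m≤o M N

    later₂ : ∀ {M N n} → M ℕ.⊔ N ℕ.≤ n → N ℕ.≤ n
    later₂ {M} {N} = ℕₚ.m⊔n≤o⇒n≤o M N

    opaque
      Small-resp : ∀ {f g} N → (∀ {m n} → N ℕ.≤ m → N ℕ.≤ n → f m n ≡ g m n) →
                   Small f → Small g
      Small-resp N f≡g sf ε 0<ε with sf ε 0<ε
      ... | M , f<ε = N ℕ.⊔ M , λ p q →
        ≡.subst (λ t → ∣ t ∣ < ε) (f≡g (later₁ p) (later₁ q)) (f<ε (later₂ {N} p) (later₂ {N} q))

    Small-≗ : ∀ {f g} → (∀ m n → f m n ≡ g m n) → Small f → Small g
    Small-≗ f≡g = Small-resp 0 (λ {m} {n} _ _ → f≡g m n)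

    opaque
      Small-+ : ∀ {f g} → Small f → Small g → Small (λ m n → f m n ℚ.+ g m n)
      Small-+ {f} {g} sf sg ε 0<ε with sf (half ε) (half>0 0<ε) | sg (half ε) (half>0 0<ε)
      ... | M , hf | N , hg = M ℕ.⊔ N , λ {m} {n} p q → begin-strict
        ∣ f m n ℚ.+ g m n ∣      ≤⟨ ℚₚ.∣p+q∣≤∣p∣+∣q∣ (f m n) (g m n) ⟩
        ∣ f m n ∣ ℚ.+ ∣ g m n ∣  <⟨ ℚₚ.+-mono-< (hf (later₁ p) (later₁ q)) (hg (later₂ {M} p) (later₂ {M} q)) ⟩
        half ε ℚ.+ half ε        ≡⟨ half+half ε ⟩
        ε                        ∎

      Small-neg : ∀ {f} → Small f → Small (λ m n → ℚ.- f m n)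
      Small-neg {f} sf ε 0<ε with sf ε 0<ε
      ... | N , h = N , λ {m} {n} p q → ≡.subst (_< ε) (≡.sym (ℚₚ.∣-p∣≡∣p∣ (f m n))) (h p q)

      Small-* : ∀ {f g} → Bounded f → Small g → Small (λ m n → f m n ℚ.* g m n)
      Small-* {f} {g} (B , 0<B , M , hf) sg ε 0<ε
        with sg (recip B ℚ.* ε) (*-pos (recip-pos 0<B) 0<ε)
      ... | N , hg = M ℕ.⊔ N , λ {m} {n} p q → begin-strict
        ∣ f m n ℚ.* g m n ∣        ≡⟨ ℚₚ.∣p*q∣≡∣p∣*∣q∣ (f m n) (g m n) ⟩
        ∣ f m n ∣ ℚ.* ∣ g m n ∣    ≤⟨ ℚₚ.*-monoʳ-≤-nonNeg ∣ g m n ∣ {{ℚ.nonNegative (ℚₚ.0≤∣p∣ (g m n))}} (hf (later₁ p) (later₁ q)) ⟩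
        B ℚ.* ∣ g m n ∣            <⟨ ℚₚ.*-monoʳ-<-pos B {{ℚ.positive 0<B}} (hg (later₂ {M} p) (later₂ {M} q)) ⟩
        B ℚ.* (recip B ℚ.* ε)      ≡⟨ ℚₚ.*-assoc B (recip B) ε ⟨
        B ℚ.* recip B ℚ.* ε        ≡⟨ ≡.cong (ℚ._* ε) (recip-inverse B (>0⇒≢0 0<B)) ⟩
        1ℚ ℚ.* ε                   ≡⟨ ℚₚ.*-identityˡ ε ⟩
        ε                          ∎

      Bounded-* : ∀ {f g} → Bounded f → Bounded g → Bounded (λ m n → f m n ℚ.* g m n)
      Bounded-* {f} {g} (B , 0<B , M , hf) (C , 0<C , N , hg) =
        B ℚ.* C , *-pos 0<B 0<C , M ℕ.⊔ N , λ {m} {n} p q → begin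
        ∣ f m n ℚ.* g m n ∣      ≡⟨ ℚₚ.∣p*q∣≡∣p∣*∣q∣ (f m n) (g m n) ⟩
        ∣ f m n ∣ ℚ.* ∣ g m n ∣  ≤⟨ ℚₚ.*-monoʳ-≤-nonNeg ∣ g m n ∣ {{ℚ.nonNegative (ℚₚ.0≤∣p∣ (g m n))}} (hf (later₁ p) (later₁ q)) ⟩
        B ℚ.* ∣ g m n ∣          ≤⟨ ℚₚ.*-monoˡ-≤-nonNeg B {{ℚ.nonNegative (ℚₚ.<⇒≤ 0<B)}} (hg (later₂ {M} p) (later₂ {M} q)) ⟩
        B ℚ.* C                  ∎

    opaque
      triangle : ∀ p q → ∣ p ∣ ≤ ∣ q ∣ ℚ.+ ∣ p ℚ.- q ∣
      triangle p q = begin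
        ∣ p ∣                    ≡⟨ ≡.cong ∣_∣ (solve 2 (λ p q → p := q :+ (p :- q)) ≡.refl p q) ⟩
        ∣ q ℚ.+ (p ℚ.- q) ∣      ≤⟨ ℚₚ.∣p+q∣≤∣p∣+∣q∣ q (p ℚ.- q) ⟩
        ∣ q ∣ ℚ.+ ∣ p ℚ.- q ∣    ∎
        where open +-*-Solver

    opaque
      0<1 : 0ℚ < 1ℚ
      0<1 = ℚₚ.positive⁻¹ 1ℚ

    opaque
      bound : ∀ x → ∃[ M ] 0ℚ < M × ∃[ N ] (∀ {n} → N ℕ.≤ n → ∣ seq x n ∣ ≤ M)
      bound x with isCauchy x 1ℚ 0<1
      ... | N , h = ∣ seq x N ∣ ℚ.+ 1ℚ
                  , ℚₚ.+-mono-≤-< (ℚₚ.0≤∣p∣ (seq x N)) 0<1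
                  , N , λ {n} p → begin
        ∣ seq x n ∣                                   ≤⟨ triangle (seq x n) (seq x N) ⟩
        ∣ seq x N ∣ ℚ.+ ∣ seq x n ℚ.- seq x N ∣       ≤⟨ ℚₚ.+-monoʳ-≤ ∣ seq x N ∣ (ℚₚ.<⇒≤ (h p ℕₚ.≤-refl)) ⟩
        ∣ seq x N ∣ ℚ.+ 1ℚ                            ∎

    opaque
      boundˡ : ∀ x → Bounded (λ m n → seq x m)
      boundˡ x with bound x
      ... | M , 0<M , N , h = M , 0<M , N , λ p q → h p

      boundʳ : ∀ x → Bounded (λ m n → seq x n)
      boundʳ x with bound x
      ... | M , 0<M , N , h = M , 0<M , N , λ p q → h q

      small : ∀ {x y} → x ≈ y → Small (λ m n → seq x n ℚ.- seq y n)
      small x≈y ε 0<ε with close x≈y ε 0<ε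
      ... | N , h = N , λ _ q → h q

      equal : ∀ {x y} → Small (λ m n → seq x n ℚ.- seq y n) → x ≈ y
      equal s .close ε 0<ε with s ε 0<ε
      ... | N , h = N , λ q → h q q

      pointwise : ∀ {x y} → (∀ n → seq x n ≡ seq y n) → x ≈ y
      pointwise {x} {y} x≡y .close ε 0<ε = 0 , λ {n} _ → ≡.subst (_< ε)
        (≡.cong ∣_∣ (≡.trans (≡.sym (ℚₚ.+-inverseʳ (seq x n))) (≡.cong (λ t → seq x n ℚ.- t) (x≡y n)))) 0<ε

  infix  8 -_
  infixl 7 _*_
  infixl 6 _+_

  private
    constant : ℚ → ℝ
    constant q .seq _ = q
    constant q .isCauchy ε 0<ε =
      0 , λ _ _ → ≡.subst (λ t → ∣ t ∣ < ε) (≡.sym (ℚₚ.+-inverseʳ q)) 0<ε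

  0ℝ 1ℝ : ℝ
  0ℝ = constant 0ℚ
  1ℝ = constant 1ℚ

  private opaque
    cauchy-+ : ∀ x y → Small (λ m n → (seq x m ℚ.+ seq y m) ℚ.- (seq x n ℚ.+ seq y n))
    cauchy-+ x y = Small-≗
      (λ m n → solve 4 (λ a b c d → (a :- b) :+ (c :- d) := (a :+ c) :- (b :+ d)) ≡.refl
                 (seq x m) (seq x n) (seq y m) (seq y n))
      (Small-+ (isCauchy x) (isCauchy y))
      where open +-*-Solver

    cauchy-* : ∀ x y → Small (λ m n → seq x m ℚ.* seq y m ℚ.- seq x n ℚ.* seq y n)
    cauchy-* x y = Small-≗
      (λ m n → solve 4 (λ a b c d → a :* (c :- d) :+ d :* (a :- b) := a :* c :- b :* d) ≡.refl
                 (seq x m) (seq x n) (seq y m) (seq y n))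
      (Small-+ (Small-* (boundˡ x) (isCauchy y)) (Small-* (boundʳ y) (isCauchy x)))
      where open +-*-Solver

    cauchy-neg : ∀ x → Small (λ m n → ℚ.- seq x m ℚ.- (ℚ.- seq x n))
    cauchy-neg x = Small-≗
      (λ m n → solve 2 (λ a b → :- (a :- b) := :- a :- (:- b)) ≡.refl (seq x m) (seq x n))
      (Small-neg (isCauchy x))
      where open +-*-Solver

  _+_ _*_ : ℝ → ℝ → ℝ
  (x + y) .seq n    = seq x n ℚ.+ seq y n
  (x + y) .isCauchy = cauchy-+ x y
  (x * y) .seq n    = seq x n ℚ.* seq y n
  (x * y) .isCauchy = cauchy-* x y

  -_ : ℝ → ℝ
  (- x) .seq n    = ℚ.- seq x n
  (- x) .isCauchy = cauchy-neg x

  private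
    ≈-refl : ∀ {x} → x ≈ x
    ≈-refl = pointwise (λ _ → ≡.refl)

    ≈-sym : ∀ {x y} → x ≈ y → y ≈ x
    ≈-sym {x} {y} p = equal (Small-≗
      (λ m n → solve 2 (λ a b → :- (a :- b) := b :- a) ≡.refl (seq x n) (seq y n))
      (Small-neg (small p)))
      where open +-*-Solver

    ≈-trans : ∀ {x y z} → x ≈ y → y ≈ z → x ≈ z
    ≈-trans {x} {y} {z} p q = equal (Small-≗
      (λ m n → solve 3 (λ a b c → (a :- b) :+ (b :- c) := a :- c) ≡.refl (seq x n) (seq y n) (seq z n))
      (Small-+ (small p) (small q)))
      where open +-*-Solver

    +-cong : ∀ {x y u v} → x ≈ y → u ≈ v → x + u ≈ y + v
    +-cong {x} {y} {u} {v} p q = equal (Small-≗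
      (λ m n → solve 4 (λ a b c d → (a :- b) :+ (c :- d) := (a :+ c) :- (b :+ d)) ≡.refl
                 (seq x n) (seq y n) (seq u n) (seq v n))
      (Small-+ (small p) (small q)))
      where open +-*-Solver

    *-cong : ∀ {x y u v} → x ≈ y → u ≈ v → x * u ≈ y * v
    *-cong {x} {y} {u} {v} p q = equal (Small-≗
      (λ m n → solve 4 (λ a b c d → a :* (c :- d) :+ d :* (a :- b) := a :* c :- b :* d) ≡.refl
                 (seq x n) (seq y n) (seq u n) (seq v n))
      (Small-+ (Small-* (boundʳ x) (small q)) (Small-* (boundʳ v) (small p))))
      where open +-*-Solver

    -‿cong : ∀ {x y} → x ≈ y → - x ≈ - y
    -‿cong {x} {y} p = equal (Small-≗
      (λ m n → solve 2 (λ a b → :- (a :- b) := :- a :- (:- b)) ≡.refl (seq x n) (seq y n))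
      (Small-neg (small p)))
      where open +-*-Solver

  isCommutativeRing : IsCommutativeRing _≈_ _+_ _*_ -_ 0ℝ 1ℝ
  isCommutativeRing = record
    { isRing = record
      { +-isAbelianGroup = record
        { isGroup = record
          { isMonoid = record
            { isSemigroup = record
              { isMagma = record
                { isEquivalence = record { refl = ≈-refl ; sym = ≈-sym ; trans = ≈-trans }
                ; ∙-cong = +-cong
                }
              ; assoc = λ x y z → pointwise (λ n → ℚₚ.+-assoc (seq x n) (seq y n) (seq z n))
              }
            ; identity = (λ x → pointwise (λ n → ℚₚ.+-identityˡ (seq x n)))
                       , (λ x → pointwise (λ n → ℚₚ.+-identityʳ (seq x n)))
            }
          ; inverse = (λ x → pointwise (λ n → ℚₚ.+-inverseˡ (seq x n)))
                    , (λ x → pointwise (λ n → ℚₚ.+-inverseʳ (seq x n)))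
          ; ⁻¹-cong = -‿cong
          }
        ; comm = λ x y → pointwise (λ n → ℚₚ.+-comm (seq x n) (seq y n))
        }
      ; *-cong = *-cong
      ; *-assoc = λ x y z → pointwise (λ n → ℚₚ.*-assoc (seq x n) (seq y n) (seq z n))
      ; *-identity = (λ x → pointwise (λ n → ℚₚ.*-identityˡ (seq x n)))
                   , (λ x → pointwise (λ n → ℚₚ.*-identityʳ (seq x n)))
      ; distrib = (λ x y z → pointwise (λ n → ℚₚ.*-distribˡ-+ (seq x n) (seq y n) (seq z n)))
                , (λ x y z → pointwise (λ n → ℚₚ.*-distribʳ-+ (seq x n) (seq y n) (seq z n)))
      }
    ; *-comm = λ x y → pointwise (λ n → ℚₚ.*-comm (seq x n) (seq y n))
    }

  private
    ∣-∣-swap : ∀ p q → ∣ p ℚ.- q ∣ ≡ ∣ q ℚ.- p ∣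
    ∣-∣-swap p q = ≡.trans (≡.sym (ℚₚ.∣-p∣≡∣p∣ (p ℚ.- q)))
      (≡.cong ∣_∣ (solve 2 (λ p q → :- (p :- q) := q :- p) ≡.refl p q))
      where open +-*-Solver

    #-irrefl : ∀ {x y} → x ≈ y → ¬ x # y
    #-irrefl x≈y x#y with close x≈y (gap x#y) (gap>0 x#y)
    ... | N , h = ℚₚ.<-irrefl ≡.refl (ℚₚ.≤-<-trans
      (distant x#y (ℕₚ.m≤m⊔n (from x#y) N)) (h (ℕₚ.m≤n⊔m (from x#y) N)))

    #-sym : ∀ {x y} → x # y → y # x
    #-sym {x} {y} x#y = record
      { gap = gap x#y ; gap>0 = gap>0 x#y ; from = from x#y
      ; distant = λ {n} p → ≡.subst (gap x#y ≤_) (∣-∣-swap (seq x n) (seq y n)) (distant x#y p) }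

    locate : ∀ x y ε → 0ℚ < ε →
             x # y ⊎ ∃[ N ] (∀ {n} → N ℕ.≤ n → ∣ seq x n ℚ.- seq y n ∣ < ε)
    locate x y ε 0<ε with isCauchy (x + (- y)) (third ε) (third>0 0<ε)
    ... | N , h with third ε ℚ.+ third ε ℚₚ.≤? ∣ seq x N ℚ.- seq y N ∣
    ... | yes far = inj₁ (record { gap = third ε ; gap>0 = third>0 0<ε ; from = N ; distant = λ {n} p →
        ℚₚ.≤-trans (ℚₚ.≤-reflexive (solve 1 (λ t → t := t :+ t :- t) ≡.refl (third ε)))
        (ℚₚ.≤-trans (ℚₚ.+-monoˡ-≤ (ℚ.- third ε) (bnd p))
          (ℚₚ.≤-reflexive (solve 2 (λ s t → s :+ t :- t := s) ≡.refl ∣ seq x n ℚ.- seq y n ∣ (third ε)))) })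
      where
      open +-*-Solver
      D : ℕ → ℚ
      D n = seq x n ℚ.- seq y n
      bnd : ∀ {n} → N ℕ.≤ n → third ε ℚ.+ third ε ≤ ∣ seq x n ℚ.- seq y n ∣ ℚ.+ third ε
      bnd {n} p = begin
        third ε ℚ.+ third ε                        ≤⟨ far ⟩
        ∣ seq x N ℚ.- seq y N ∣                    ≤⟨ triangle (D N) (D n) ⟩
        ∣ D n ∣ ℚ.+ ∣ D N ℚ.- D n ∣              ≤⟨ ℚₚ.+-monoʳ-≤ ∣ D n ∣ (ℚₚ.<⇒≤ (h (ℕₚ.≤-refl {N}) p)) ⟩
        ∣ seq x n ℚ.- seq y n ∣ ℚ.+ third ε        ∎
    ... | no ¬far = inj₂ (N , λ {n} p → begin-strict
        ∣ seq x n ℚ.- seq y n ∣                    ≤⟨ triangle (D n) (D N) ⟩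
        ∣ D N ∣ ℚ.+ ∣ D n ℚ.- D N ∣              <⟨ ℚₚ.+-mono-< (ℚₚ.≰⇒> ¬far) (h p (ℕₚ.≤-refl {N})) ⟩
        third ε ℚ.+ third ε ℚ.+ third ε            ≡⟨ third+third+third ε ⟩
        ε                                          ∎)
      where
      D : ℕ → ℚ
      D n = seq x n ℚ.- seq y n

    #-tight : ∀ x y → ¬ x # y → x ≈ y
    #-tight x y ¬x#y .close ε 0<ε with locate x y ε 0<ε
    ... | inj₁ x#y = contradiction x#y ¬x#y
    ... | inj₂ c   = c

    #-cotrans : ∀ {x y} → x # y → ∀ z → x # z ⊎ z # y
    #-cotrans {x} {y} x#y z with locate x z (half (gap x#y)) (half>0 (gap>0 x#y))
    ... | inj₁ x#z     = inj₁ x#z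
    ... | inj₂ (N , h) = inj₂ (record { gap = δ ; gap>0 = half>0 (gap>0 x#y) ; from = from x#y ℕ.⊔ N ; distant = λ {n} p →
        ℚₚ.≤-trans (ℚₚ.≤-reflexive (solve 1 (λ t → t := t :+ t :- t) ≡.refl δ))
        (ℚₚ.≤-trans (ℚₚ.+-monoˡ-≤ (ℚ.- δ) (bnd p))
          (ℚₚ.≤-reflexive (solve 2 (λ s t → s :+ t :- t := s) ≡.refl ∣ seq z n ℚ.- seq y n ∣ δ))) })
      where
      open +-*-Solver
      δ = half (gap x#y)
      bnd : ∀ {n} → from x#y ℕ.⊔ N ℕ.≤ n → δ ℚ.+ δ ≤ ∣ seq z n ℚ.- seq y n ∣ ℚ.+ δ
      bnd {n} p = begin
        δ ℚ.+ δ                                              ≡⟨ half+half (gap x#y) ⟩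
        gap x#y                                              ≤⟨ distant x#y (later₁ p) ⟩
        ∣ seq x n ℚ.- seq y n ∣                              ≡⟨ ≡.cong ∣_∣ (solve 3 (λ x y z → x :- y := (z :- y) :+ (x :- z)) ≡.refl (seq x n) (seq y n) (seq z n)) ⟩
        ∣ (seq z n ℚ.- seq y n) ℚ.+ (seq x n ℚ.- seq z n) ∣  ≤⟨ ℚₚ.∣p+q∣≤∣p∣+∣q∣ (seq z n ℚ.- seq y n) (seq x n ℚ.- seq z n) ⟩
        ∣ seq z n ℚ.- seq y n ∣ ℚ.+ ∣ seq x n ℚ.- seq z n ∣  ≤⟨ ℚₚ.+-monoʳ-≤ ∣ seq z n ℚ.- seq y n ∣ (ℚₚ.<⇒≤ (h (later₂ {from x#y} p))) ⟩
        ∣ seq z n ℚ.- seq y n ∣ ℚ.+ δ                        ∎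

    -- The pointwise reciprocal of a sequence bounded away from 0.
    module Reciprocal (d : ℝ) (η : ℚ) (0<η : 0ℚ < η) (K : ℕ)
                      (away : ∀ {n} → K ℕ.≤ n → η ≤ ∣ seq d n ∣) where
      d≢0 : ∀ {n} → K ℕ.≤ n → ¬ seq d n ≡ 0ℚ
      d≢0 p d≡0 = ℚₚ.<-irrefl ≡.refl (ℚₚ.<-≤-trans 0<η (≡.subst (λ t → η ≤ ∣ t ∣) d≡0 (away p)))

      inv : ∀ {n} → K ℕ.≤ n → seq d n ℚ.* recip (seq d n) ≡ 1ℚ
      inv {n} p = recip-inverse (seq d n) (d≢0 p)

      bnd : ∀ {n} → K ℕ.≤ n → ∣ recip (seq d n) ∣ ≤ recip η
      bnd {n} p = ℚₚ.*-cancelˡ-≤-pos η {{ℚ.positive 0<η}} (begin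
        η ℚ.* ∣ recip (seq d n) ∣            ≤⟨ ℚₚ.*-monoʳ-≤-nonNeg _ {{ℚ.nonNegative (ℚₚ.0≤∣p∣ (recip (seq d n)))}} (away p) ⟩
        ∣ seq d n ∣ ℚ.* ∣ recip (seq d n) ∣  ≡⟨ ℚₚ.∣p*q∣≡∣p∣*∣q∣ (seq d n) (recip (seq d n)) ⟨
        ∣ seq d n ℚ.* recip (seq d n) ∣      ≡⟨ ≡.cong ∣_∣ (inv p) ⟩
        1ℚ                                   ≡⟨ recip-inverse η (>0⇒≢0 0<η) ⟨
        η ℚ.* recip η                        ∎)

      reciprocal : ℝ
      reciprocal .seq n = recip (seq d n)
      reciprocal .isCauchy = Small-resp K eq
        (Small-* (Bounded-* (recip η , recip-pos 0<η , K , λ p q → bnd p)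
                            (recip η , recip-pos 0<η , K , λ p q → bnd q))
                 (Small-neg (isCauchy d)))
        where
        open +-*-Solver
        eq : ∀ {m n} → K ℕ.≤ m → K ℕ.≤ n →
             recip (seq d m) ℚ.* recip (seq d n) ℚ.* (ℚ.- (seq d m ℚ.- seq d n))
             ≡ recip (seq d m) ℚ.- recip (seq d n)
        eq {m} {n} p q = begin-equality
          recip (seq d m) ℚ.* recip (seq d n) ℚ.* (ℚ.- (seq d m ℚ.- seq d n))
            ≡⟨ solve 4 (λ a b r s → r :* s :* (:- (a :- b)) := r :* (b :* s) :- s :* (a :* r)) ≡.refl
                 (seq d m) (seq d n) (recip (seq d m)) (recip (seq d n)) ⟩
          recip (seq d m) ℚ.* (seq d n ℚ.* recip (seq d n)) ℚ.- recip (seq d n) ℚ.* (seq d m ℚ.* recip (seq d m))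
            ≡⟨ ≡.cong₂ (λ s t → recip (seq d m) ℚ.* s ℚ.- recip (seq d n) ℚ.* t) (inv q) (inv p) ⟩
          recip (seq d m) ℚ.* 1ℚ ℚ.- recip (seq d n) ℚ.* 1ℚ
            ≡⟨ ≡.cong₂ ℚ._-_ (ℚₚ.*-identityʳ (recip (seq d m))) (ℚₚ.*-identityʳ (recip (seq d n))) ⟩
          recip (seq d m) ℚ.- recip (seq d n) ∎

      inverseʳ : d * reciprocal ≈ 1ℝ
      inverseʳ .close ε 0<ε = K , λ p →
        ≡.subst (λ t → ∣ t ℚ.- 1ℚ ∣ < ε) (≡.sym (inv p)) 0<ε

    #⇒inverse : ∀ {x y} → x # y → ∃[ z ] ((z * (x + (- y))) ≈ 1ℝ × ((x + (- y)) * z) ≈ 1ℝ)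
    #⇒inverse {x} {y} x#y = reciprocal
      , ≈-trans (pointwise (λ n → ℚₚ.*-comm (recip (seq x n ℚ.- seq y n)) (seq x n ℚ.- seq y n))) inverseʳ
      , inverseʳ
      where open Reciprocal (x + (- y)) (gap x#y) (gap>0 x#y) (from x#y) (distant x#y)

    inverse⇒# : ∀ {x y} → ∃[ z ] ((z * (x + (- y))) ≈ 1ℝ × ((x + (- y)) * z) ≈ 1ℝ) → x # y
    inverse⇒# {x} {y} (z , zd≈1 , _) with close zd≈1 ½ (ℚₚ.positive⁻¹ ½) | bound z
    ... | N , h | B , 0<B , M , hz = record
      { gap = recip B ℚ.* ½ ; gap>0 = *-pos (recip-pos 0<B) (ℚₚ.positive⁻¹ ½) ; from = N ℕ.⊔ M
      ; distant = λ {n} p → ℚₚ.*-cancelˡ-≤-pos B {{ℚ.positive 0<B}} (begin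
          B ℚ.* (recip B ℚ.* ½)                 ≡⟨ ℚₚ.*-assoc B (recip B) ½ ⟨
          B ℚ.* recip B ℚ.* ½                   ≡⟨ ≡.cong (ℚ._* ½) (recip-inverse B (>0⇒≢0 0<B)) ⟩
          1ℚ ℚ.- ½                              ≤⟨ ℚₚ.+-monoˡ-≤ (ℚ.- ½) (one p) ⟩
          ∣ seq z n ℚ.* d n ∣ ℚ.+ ½ ℚ.- ½       ≡⟨ solve 2 (λ s t → s :+ t :- t := s) ≡.refl ∣ seq z n ℚ.* d n ∣ ½ ⟩
          ∣ seq z n ℚ.* d n ∣                   ≡⟨ ℚₚ.∣p*q∣≡∣p∣*∣q∣ (seq z n) (d n) ⟩
          ∣ seq z n ∣ ℚ.* ∣ d n ∣               ≤⟨ ℚₚ.*-monoʳ-≤-nonNeg ∣ d n ∣ {{ℚ.nonNegative (ℚₚ.0≤∣p∣ (d n))}} (hz (later₂ {N} p)) ⟩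
          B ℚ.* ∣ d n ∣                         ∎) }
      where
      open +-*-Solver
      d : ℕ → ℚ
      d n = seq x n ℚ.- seq y n
      one : ∀ {n} → N ℕ.⊔ M ℕ.≤ n → 1ℚ ≤ ∣ seq z n ℚ.* d n ∣ ℚ.+ ½
      one {n} p = begin
        ∣ 1ℚ ∣                                               ≤⟨ triangle 1ℚ (seq z n ℚ.* d n) ⟩
        ∣ seq z n ℚ.* d n ∣ ℚ.+ ∣ 1ℚ ℚ.- seq z n ℚ.* d n ∣   ≡⟨ ≡.cong (∣ seq z n ℚ.* d n ∣ ℚ.+_) (∣-∣-swap 1ℚ (seq z n ℚ.* d n)) ⟩
        ∣ seq z n ℚ.* d n ∣ ℚ.+ ∣ seq z n ℚ.* d n ℚ.- 1ℚ ∣   ≤⟨ ℚₚ.+-monoʳ-≤ ∣ seq z n ℚ.* d n ∣ (ℚₚ.<⇒≤ (h (later₁ p))) ⟩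
        ∣ seq z n ℚ.* d n ∣ ℚ.+ ½                            ∎

  heytingField : HeytingField 0ℓ 0ℓ 0ℓ
  heytingField = record
    { Carrier = ℝ ; _≈_ = _≈_ ; _#_ = _#_ ; _+_ = _+_ ; _*_ = _*_ ; -_ = -_ ; 0# = 0ℝ ; 1# = 1ℝ
    ; isHeytingField = record
      { isHeytingCommutativeRing = record
        { isCommutativeRing = isCommutativeRing
        ; isApartnessRelation = record { irrefl = #-irrefl ; sym = #-sym ; cotrans = #-cotrans }
        ; #⇒invertible = #⇒inverse
        ; invertible⇒# = inverse⇒#
        }
      ; tight = λ x y → #-tight x y , #-irrefl
      }
    }

  private
    square≥0 : ∀ p → 0ℚ ≤ p ℚ.* p
    square≥0 p with ℚₚ.≤-total 0ℚ p
    ... | inj₁ 0≤p = ≡.subst (_≤ p ℚ.* p) (ℚₚ.*-zeroʳ p) (ℚₚ.*-monoˡ-≤-nonNeg p {{ℚ.nonNegative 0≤p}} 0≤p)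
    ... | inj₂ p≤0 = ≡.subst (_≤ p ℚ.* p) (ℚₚ.*-zeroʳ p) (ℚₚ.*-monoˡ-≤-nonPos p {{ℚ.nonPositive p≤0}} p≤0)

  sumOfSquares#0 : FieldProperties.SumOfSquares#0 heytingField
  sumOfSquares#0 x y x#0 = record
    { gap = η ℚ.* η ; gap>0 = *-pos 0<η 0<η ; from = from x#0
    ; distant = λ {n} p → let a = seq x n ; b = seq y n in begin
        η ℚ.* η                           ≤⟨ ℚₚ.*-monoˡ-≤-nonNeg η {{ηnn}} (away p) ⟩
        η ℚ.* ∣ a ∣                       ≤⟨ ℚₚ.*-monoʳ-≤-nonNeg ∣ a ∣ {{ℚ.nonNegative (ℚₚ.0≤∣p∣ a)}} (away p) ⟩
        ∣ a ∣ ℚ.* ∣ a ∣                   ≡⟨ ℚₚ.∣p*q∣≡∣p∣*∣q∣ a a ⟨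
        ∣ a ℚ.* a ∣                       ≡⟨ ℚₚ.0≤p⇒∣p∣≡p (square≥0 a) ⟩
        a ℚ.* a                           ≡⟨ ℚₚ.+-identityʳ (a ℚ.* a) ⟨
        a ℚ.* a ℚ.+ 0ℚ                    ≤⟨ ℚₚ.+-monoʳ-≤ (a ℚ.* a) (square≥0 b) ⟩
        a ℚ.* a ℚ.+ b ℚ.* b               ≡⟨ ℚₚ.0≤p⇒∣p∣≡p (ℚₚ.+-mono-≤ (square≥0 a) (square≥0 b)) ⟨
        ∣ a ℚ.* a ℚ.+ b ℚ.* b ∣           ≡⟨ ≡.cong ∣_∣ (ℚₚ.+-identityʳ (a ℚ.* a ℚ.+ b ℚ.* b)) ⟨
        ∣ a ℚ.* a ℚ.+ b ℚ.* b ℚ.- 0ℚ ∣    ∎ }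
    where
    η = gap x#0
    0<η = gap>0 x#0
    ηnn = ℚ.nonNegative (ℚₚ.<⇒≤ 0<η)
    away : ∀ {n} → from x#0 ℕ.≤ n → η ≤ ∣ seq x n ∣
    away {n} p = ≡.subst (λ t → η ≤ ∣ t ∣) (ℚₚ.+-identityʳ (seq x n)) (distant x#0 p)

  open FieldProperties heytingField using (_·_)

  private
    ·1≥0 : ∀ n k → 0ℚ ≤ seq (n · 1ℝ) k
    ·1≥0 zero    k = ℚₚ.≤-refl
    ·1≥0 (suc n) k = ℚₚ.+-mono-≤ (ℚₚ.<⇒≤ 0<1) (·1≥0 n k)

  characteristic0 : FieldProperties.Characteristic0 heytingField
  characteristic0 n = record { gap = 1ℚ ; gap>0 = 0<1 ; from = 0 ; distant = λ {k} _ →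
    let s = seq (suc n · 1ℝ) k
        1≤s : 1ℚ ≤ s
        1≤s = ℚₚ.+-monoʳ-≤ 1ℚ (·1≥0 n k)
    in begin
      1ℚ             ≤⟨ 1≤s ⟩
      s              ≡⟨ ℚₚ.0≤p⇒∣p∣≡p (ℚₚ.≤-trans (ℚₚ.<⇒≤ 0<1) 1≤s) ⟨
      ∣ s ∣          ≡⟨ ≡.cong ∣_∣ (ℚₚ.+-identityʳ s) ⟨
      ∣ s ℚ.- 0ℚ ∣   ∎ }

-- The field F(i), with elements re + im · i.
module AdjoinI {c ℓ₁ ℓ₂} (F : HeytingField c ℓ₁ ℓ₂)
  (sumOfSquares#0 : FieldProperties.SumOfSquares#0 F)
  where

  open HeytingField F
  open FieldProperties F
  open HeytingProperties heytingCommutativeRing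
  open HeytingCommutativeRing heytingCommutativeRing using (commutativeRing)
  open CommutativeRing commutativeRing using (ring)
  open RingProperties ring

  record F[i] : Set c where
    constructor _+i_
    field
      re im : Carrier

  open F[i] public

  infix 4 _≈ᶜ_ _#ᶜ_

  record _≈ᶜ_ (z w : F[i]) : Set ℓ₁ where
    constructor _,_
    field
      re≈ : re z ≈ re w
      im≈ : im z ≈ im w

  record _#ᶜ_ (z w : F[i]) : Set ℓ₂ where
    constructor mk#
    field
      re#⊎im# : re z # re w ⊎ im z # im w

  infix  8 -ᶜ_
  infixl 7 _*ᶜ_
  infixl 6 _+ᶜ_

  _+ᶜ_ _*ᶜ_ : F[i] → F[i] → F[i]
  re (z +ᶜ w) = re z + re w
  im (z +ᶜ w) = im z + im w
  re (z *ᶜ w) = re z * re w - im z * im w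
  im (z *ᶜ w) = re z * im w + im z * re w

  -ᶜ_ : F[i] → F[i]
  re (-ᶜ z) = - re z
  im (-ᶜ z) = - im z

  0ᶜ 1ᶜ : F[i]
  0ᶜ = 0# +i 0#
  1ᶜ = 1# +i 0#

  private
    open NaturalSolver (CommutativeRing.commutativeSemiring commutativeRing)

    neg : ∀ x → - x ≈ - 1# * x
    neg x = sym (-1*x≈-x x)

    *-congᶜ : ∀ {z w u v} → z ≈ᶜ w → u ≈ᶜ v → z *ᶜ u ≈ᶜ w *ᶜ v
    *-congᶜ (p , q) (r , s) =
        +-cong (*-cong p r) (-‿cong (*-cong q s))
      , +-cong (*-cong p s) (*-cong q r)

    *-assocᶜ : ∀ z w u → (z *ᶜ w) *ᶜ u ≈ᶜ z *ᶜ (w *ᶜ u)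
    *-assocᶜ (a +i b) (c +i d) (e +i f) =
        trans (+-cong (*-congʳ (+-congˡ (neg _))) (neg _))
          (trans (solve 7 (λ a b c d e f n →
                   (a :* c :+ n :* (b :* d)) :* e :+ n :* ((a :* d :+ b :* c) :* f)
                   := a :* (c :* e :+ n :* (d :* f)) :+ n :* (b :* (c :* f :+ d :* e)))
                   refl a b c d e f (- 1#))
            (sym (+-cong (*-congˡ (+-congˡ (neg _))) (neg _))))
      , trans (+-congʳ (*-congʳ (+-congˡ (neg _))))
          (trans (solve 7 (λ a b c d e f n →
                   (a :* c :+ n :* (b :* d)) :* f :+ (a :* d :+ b :* c) :* e
                   := a :* (c :* f :+ d :* e) :+ b :* (c :* e :+ n :* (d :* f)))
                   refl a b c d e f (- 1#))
            (sym (+-congˡ (*-congˡ (+-congˡ (neg _))))))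

    *-commᶜ : ∀ z w → z *ᶜ w ≈ᶜ w *ᶜ z
    *-commᶜ z w =
        +-cong (*-comm _ _) (-‿cong (*-comm _ _))
      , trans (+-comm _ _) (+-cong (*-comm _ _) (*-comm _ _))

    *-identityˡᶜ : ∀ z → 1ᶜ *ᶜ z ≈ᶜ z
    *-identityˡᶜ z =
        trans (+-cong (*-identityˡ _) (trans (-‿cong (zeroˡ _)) -0#≈0#)) (+-identityʳ _)
      , trans (+-cong (*-identityˡ _) (zeroˡ _)) (+-identityʳ _)

    *-distribˡᶜ : ∀ z w u → z *ᶜ (w +ᶜ u) ≈ᶜ (z *ᶜ w) +ᶜ (z *ᶜ u)
    *-distribˡᶜ (a +i b) (c +i d) (e +i f) =
        trans (+-congˡ (neg _))
          (trans (solve 7 (λ a b c d e f n →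
                   a :* (c :+ e) :+ n :* (b :* (d :+ f))
                   := (a :* c :+ n :* (b :* d)) :+ (a :* e :+ n :* (b :* f)))
                   refl a b c d e f (- 1#))
            (sym (+-cong (+-congˡ (neg _)) (+-congˡ (neg _)))))
      , solve 6 (λ a b c d e f →
          a :* (d :+ f) :+ b :* (c :+ e)
          := (a :* d :+ b :* c) :+ (a :* f :+ b :* e))
          refl a b c d e f

    transᶜ : ∀ {z w u} → z ≈ᶜ w → w ≈ᶜ u → z ≈ᶜ u
    transᶜ (p , q) (r , s) = trans p r , trans q s

    +-congᶜ : ∀ {z w u v} → z ≈ᶜ w → u ≈ᶜ v → z +ᶜ u ≈ᶜ w +ᶜ v
    +-congᶜ (p , q) (r , s) = +-cong p r , +-cong q s

  isCommutativeRingᶜ : IsCommutativeRing _≈ᶜ_ _+ᶜ_ _*ᶜ_ -ᶜ_ 0ᶜ 1ᶜ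
  isCommutativeRingᶜ = record
    { isRing = record
      { +-isAbelianGroup = record
        { isGroup = record
          { isMonoid = record
            { isSemigroup = record
              { isMagma = record
                { isEquivalence = record
                  { refl  = refl , refl
                  ; sym   = λ { (p , q) → sym p , sym q }
                  ; trans = transᶜ }
                ; ∙-cong = +-congᶜ
                }
              ; assoc = λ z w u → +-assoc _ _ _ , +-assoc _ _ _
              }
            ; identity = (λ z → +-identityˡ _ , +-identityˡ _)
                       , (λ z → +-identityʳ _ , +-identityʳ _)
            }
          ; inverse = (λ z → -‿inverseˡ _ , -‿inverseˡ _)
                    , (λ z → -‿inverseʳ _ , -‿inverseʳ _)
          ; ⁻¹-cong = λ { (p , q) → -‿cong p , -‿cong q }
          }
        ; comm = λ z w → +-comm _ _ , +-comm _ _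
        }
      ; *-cong = *-congᶜ
      ; *-assoc = *-assocᶜ
      ; *-identity = *-identityˡᶜ
                   , (λ z → transᶜ (*-commᶜ z 1ᶜ) (*-identityˡᶜ z))
      ; distrib = *-distribˡᶜ
                , (λ z w u → transᶜ (*-commᶜ (w +ᶜ u) z)
                     (transᶜ (*-distribˡᶜ z w u) (+-congᶜ (*-commᶜ z w) (*-commᶜ z u))))
      }
    ; *-comm = *-commᶜ
    }

  private
    norm#0 : ∀ z → z #ᶜ 0ᶜ → re z * re z + im z * im z # 0#
    norm#0 z (mk# (inj₁ re#0)) = sumOfSquares#0 (re z) (im z) re#0
    norm#0 z (mk# (inj₂ im#0)) = #-congʳ (+-comm _ _) (sumOfSquares#0 (im z) (re z) im#0)

    #0⇒inverseᶜ : ∀ z → z #ᶜ 0ᶜ → ∃[ w ] (z *ᶜ w ≈ᶜ 1ᶜ)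
    #0⇒inverseᶜ z z#0 = (re z * t) +i (- (im z * t)) , (real , imag)
      where
      open SetoidReasoning setoid
      t = inverse _ (norm#0 z z#0)
      real : re z * (re z * t) - im z * (- (im z * t)) ≈ 1#
      real = begin
        re z * (re z * t) - im z * (- (im z * t))
          ≈⟨ +-congˡ (-‿cong (sym (-‿distribʳ-* _ _))) ⟩
        re z * (re z * t) - (- (im z * (im z * t)))
          ≈⟨ +-cong (sym (*-assoc _ _ _)) (trans (-‿involutive _) (sym (*-assoc _ _ _))) ⟩
        re z * re z * t + im z * im z * t
          ≈⟨ distribʳ _ _ _ ⟨
        (re z * re z + im z * im z) * t
          ≈⟨ inverseʳ _ (norm#0 z z#0) ⟩
        1# ∎
      imag : re z * (- (im z * t)) + im z * (re z * t) ≈ 0#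
      imag = begin
        re z * (- (im z * t)) + im z * (re z * t)
          ≈⟨ +-cong (sym (-‿distribʳ-* _ _)) (x∙yz≈y∙xz _ _ _) ⟩
        - (re z * (im z * t)) + re z * (im z * t)
          ≈⟨ -‿inverseˡ _ ⟩
        0# ∎
        where
        open import Algebra.Properties.CommutativeSemigroup
          (CommutativeRing.*-commutativeSemigroup commutativeRing) using (x∙yz≈y∙xz)

    *-#0ˡᶜ : ∀ z w → z *ᶜ w ≈ᶜ 1ᶜ → z #ᶜ 0ᶜ
    *-#0ˡᶜ z w (re≈ , _) with +-#0 (#-congʳ (sym re≈) 1#0)
    ... | inj₁ p = mk# (inj₁ (*-#0ˡ p))
    ... | inj₂ p = mk# (inj₂ (*-#0ˡ (-x#0⇒x#0 p)))

    cotransᶜ : ∀ {z w} → z #ᶜ w → ∀ u → z #ᶜ u ⊎ u #ᶜ w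
    cotransᶜ (mk# (inj₁ p)) u = Sum.map (λ q → mk# (inj₁ q)) (λ q → mk# (inj₁ q)) (#-cotrans p (re u))
    cotransᶜ (mk# (inj₂ p)) u = Sum.map (λ q → mk# (inj₂ q)) (λ q → mk# (inj₂ q)) (#-cotrans p (im u))

    irreflᶜ : ∀ {z w} → z ≈ᶜ w → ¬ z #ᶜ w
    irreflᶜ (p , q) (mk# r) = [ #-irrefl p , #-irrefl q ]′ r

  heytingFieldᶜ : HeytingField c ℓ₁ ℓ₂
  heytingFieldᶜ = record
    { Carrier = F[i] ; _≈_ = _≈ᶜ_ ; _#_ = _#ᶜ_
    ; _+_ = _+ᶜ_ ; _*_ = _*ᶜ_ ; -_ = -ᶜ_ ; 0# = 0ᶜ ; 1# = 1ᶜ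
    ; isHeytingField = record
      { isHeytingCommutativeRing = record
        { isCommutativeRing = isCommutativeRingᶜ
        ; isApartnessRelation = record
          { irrefl  = irreflᶜ
          ; sym     = λ { (mk# p) → mk# (Sum.map #-sym #-sym p) }
          ; cotrans = cotransᶜ
          }
        ; #⇒invertible = λ { {z} {w} (mk# p) →
            let u , eq = #0⇒inverseᶜ (z +ᶜ (-ᶜ w)) (mk# (Sum.map #⇒-#0 #⇒-#0 p))
            in u , transᶜ (*-commᶜ u _) eq , eq }
        ; invertible⇒# = λ { {z} {w} (u , _ , eq) →
            mk# (Sum.map -#0⇒# -#0⇒# (_#ᶜ_.re#⊎im# (*-#0ˡᶜ (z +ᶜ (-ᶜ w)) u eq))) }
        }
      ; tight = λ z w → (λ ¬z#w → proj₁ (tight (re z) (re w)) (λ p → ¬z#w (mk# (inj₁ p)))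
                                , proj₁ (tight (im z) (im w)) (λ p → ¬z#w (mk# (inj₂ p))))
                      , irreflᶜ
      }
    }

  open FieldProperties heytingFieldᶜ using () renaming (_·_ to _·ᶜ_)

  characteristic0ᶜ : Characteristic0 → FieldProperties.Characteristic0 heytingFieldᶜ
  characteristic0ᶜ char0 n = mk# (inj₁ (#-congʳ (sym (re-·1 (suc n))) (char0 n)))
    where
    re-·1 : ∀ n → re (n ·ᶜ 1ᶜ) ≈ n · 1#
    re-·1 zero    = refl
    re-·1 (suc n) = +-congˡ (re-·1 n)

module PowerSeries {c ℓ₁ ℓ₂} (F : HeytingField c ℓ₁ ℓ₂) where
  open HeytingField F
  open HeytingCommutativeRing heytingCommutativeRing using (commutativeRing)
  open CommutativeRing commutativeRing using (+-monoid)
  open FieldProperties F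
  open MonoidSum +-monoid using (sum; sum-cong-≋)

  sumUpTo : ℕ → (ℕ → Carrier) → Carrier
  sumUpTo n f = sum {suc n} (λ k → f (toℕ k))

  infixl 10 sumUpTo
  syntax sumUpTo n (λ k → x) = ∑[0≤ k ≤ n ] x

  Series : Set c
  Series = ℕ → Carrier

  one var : Series
  one zero    = 1#
  one (suc _) = 0#
  var zero    = 0#
  var (suc n) = one n

  infixl 7 _⊛_ _⊘_[_]

  _⊛_ : Series → Series → Series
  (f ⊛ g) n = ∑[0≤ k ≤ n ] (f k * g (n ∸ k))

  private module Quotient (h f : Series) (f₀#0 : f 0 # 0#) where

    mutual
      quotient : Series
      quotient n = next n (previous n)

      -- quotient (n ∸ 1) ∷ … ∷ quotient 0 ∷ []
      previous : ∀ n → Vec Carrier n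
      previous zero    = []
      previous (suc n) = next n (previous n) ∷ previous n

      next : ∀ n → Vec Carrier n → Carrier
      next n qs = inverse (f 0) f₀#0 *
        (h n - sum (λ (k : Fin n) → f (suc (toℕ k)) * lookup qs k))

    lookup-previous : ∀ {n} (k : Fin n) → lookup (previous n) k ≡ quotient (n ∸ suc (toℕ k))
    lookup-previous {suc n} Fin.zero    = ≡.refl
    lookup-previous {suc n} (Fin.suc k) = lookup-previous k

    quotient-spec : ∀ n → (f ⊛ quotient) n ≈ h n
    quotient-spec n = begin
      f 0 * (inverse (f 0) f₀#0 * (h n - s)) + s′  ≈⟨ +-cong (sym (*-assoc _ _ _)) s′≈s ⟩
      f 0 * inverse (f 0) f₀#0 * (h n - s) + s     ≈⟨ +-congʳ (*-congʳ (inverseʳ (f 0) f₀#0)) ⟩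
      1# * (h n - s) + s                           ≈⟨ +-congʳ (*-identityˡ _) ⟩
      h n - s + s                                  ≈⟨ +-assoc _ _ _ ⟩
      h n + (- s + s)                              ≈⟨ +-congˡ (-‿inverseˡ s) ⟩
      h n + 0#                                     ≈⟨ +-identityʳ (h n) ⟩
      h n                                          ∎
      where
      open SetoidReasoning setoid
      s s′ : Carrier
      s  = sum (λ (k : Fin n) → f (suc (toℕ k)) * lookup (previous n) k)
      s′ = sum (λ (k : Fin n) → f (suc (toℕ k)) * quotient (n ∸ suc (toℕ k)))
      s′≈s : s′ ≈ s
      s′≈s = sum-cong-≋ {n} (λ k → *-congˡ {f (suc (toℕ k))} (reflexive (≡.sym (lookup-previous k))))

  opaque
    _⊘_[_] : (h f : Series) → f 0 # 0# → Series
    h ⊘ f [ f₀#0 ] = Quotient.quotient h f f₀#0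

    ⊘-spec : ∀ h f (f₀#0 : f 0 # 0#) n → (f ⊛ (h ⊘ f [ f₀#0 ])) n ≈ h n
    ⊘-spec = Quotient.quotient-spec

module ApostolBernoulli {c ℓ₁ ℓ₂} (F : HeytingField c ℓ₁ ℓ₂)
  (characteristic0 : FieldProperties.Characteristic0 F)
  where

  open HeytingField F
  open HeytingCommutativeRing heytingCommutativeRing using (commutativeRing)
  open CommutativeRing commutativeRing using (ring; commutativeSemiring; +-monoid)
  open HeytingProperties heytingCommutativeRing
  open FieldProperties F
  open PowerSeries F public
  open NumericalSemigroup
  open MonoidSum +-monoid using (sum-cong-≋)
  open Exp commutativeSemiring using (_^_; ^-congˡ; ^-assocʳ) public

  fromℕ : ℕ → Carrier
  fromℕ n = n · 1#

  1/ℕ : ∀ n .{{_ : ℕ.NonZero n}} → Carrier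
  1/ℕ (suc n) = inverse (fromℕ (suc n)) (characteristic0 n)

  fromℕ*1/ℕ : ∀ n .{{_ : ℕ.NonZero n}} → fromℕ n * 1/ℕ n ≈ 1#
  fromℕ*1/ℕ (suc n) = inverseʳ _ (characteristic0 n)

  1/[_!] : ℕ → Carrier
  1/[ n !] = 1/ℕ (n !) {{n !≢0}}

  egf : (ℕ → Carrier) → Series
  egf β n = β n * 1/[ n !]

  μeᶻ-1 : Carrier → Series
  μeᶻ-1 μ n = μ * 1/[ n !] - one n

  private
    1/0!≈1 : 1/[ 0 !] ≈ 1#
    1/0!≈1 = trans (sym (*-identityˡ _))
      (trans (*-congʳ (sym (+-identityʳ 1#))) (inverseʳ _ (characteristic0 0)))

    μ*1/0!≈μ : ∀ μ → μ * 1/[ 0 !] ≈ μ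
    μ*1/0!≈μ μ = trans (*-congˡ 1/0!≈1) (*-identityʳ μ)

    1/ℕ#0 : ∀ n .{{_ : ℕ.NonZero n}} → 1/ℕ n # 0#
    1/ℕ#0 n = *-#0ʳ (#-congʳ (sym (fromℕ*1/ℕ n)) 1#0)

    egf-! : ∀ (g : Series) n → egf (λ n → fromℕ (n !) * g n) n ≈ g n
    egf-! g n = trans (*-congʳ (*-comm (fromℕ (n !)) (g n)))
      (trans (*-assoc (g n) (fromℕ (n !)) (1/[ n !]))
        (trans (*-congˡ (fromℕ*1/ℕ (n !) {{n !≢0}})) (*-identityʳ (g n))))

    ⊛-congʳ : ∀ f {g h : Series} → (∀ n → g n ≈ h n) → ∀ n → (f ⊛ g) n ≈ (f ⊛ h) n
    ⊛-congʳ f g≈h n = sum-cong-≋ {suc n} (λ k → *-congˡ {f (toℕ k)} (g≈h (n ∸ toℕ k)))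

    μeᶻ-1₀#0 : ∀ {μ} → μ # 1# → μeᶻ-1 μ 0 # 0#
    μeᶻ-1₀#0 {μ} μ#1 = #-congʳ (+-congʳ (sym (μ*1/0!≈μ μ))) (#⇒-#0 μ#1)

    eᶻ-1₀≈0 : μeᶻ-1 1# 0 ≈ 0#
    eᶻ-1₀≈0 = trans (+-congʳ (μ*1/0!≈μ 1#)) (-‿inverseʳ 1#)

    eᶻ-1₁#0 : μeᶻ-1 1# 1 # 0#
    eᶻ-1₁#0 = #-congʳ (sym (trans (x-0≈x _) (*-identityˡ _))) (1/ℕ#0 1)

  z/[μeᶻ-1] : ∀ μ → μ # 1# → Series
  z/[μeᶻ-1] μ μ#1 = var ⊘ μeᶻ-1 μ [ μeᶻ-1₀#0 μ#1 ]

  -- e ^ z - 1 has constant term 0, so numerator and denominator are first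
  -- divided by z.
  z/[eᶻ-1] : Series
  z/[eᶻ-1] = one ⊘ (λ n → μeᶻ-1 1# (suc n)) [ eᶻ-1₁#0 ]

  𝓑 : (μ : Carrier) → μ # 1# → ℕ → Carrier
  𝓑 μ μ#1 n = fromℕ (n !) * z/[μeᶻ-1] μ μ#1 n

  B : ℕ → Carrier
  B n = fromℕ (n !) * z/[eᶻ-1] n

  𝓑-spec : ∀ μ (μ#1 : μ # 1#) n → (μeᶻ-1 μ ⊛ egf (𝓑 μ μ#1)) n ≈ var n
  𝓑-spec μ μ#1 n = trans
    (⊛-congʳ (μeᶻ-1 μ) (egf-! (z/[μeᶻ-1] μ μ#1)) n)
    (⊘-spec var (μeᶻ-1 μ) (μeᶻ-1₀#0 μ#1) n)

  B-spec : ∀ n → (μeᶻ-1 1# ⊛ egf B) n ≈ var n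
  B-spec zero    = trans (+-identityʳ _) (trans (*-congʳ eᶻ-1₀≈0) (zeroˡ _))
  B-spec (suc n) = begin
    μeᶻ-1 1# 0 * egf B (suc n) + (tail ⊛ egf B) n  ≈⟨ +-congʳ (*-congʳ eᶻ-1₀≈0) ⟩
    0# * egf B (suc n) + (tail ⊛ egf B) n          ≈⟨ +-congʳ (zeroˡ _) ⟩
    0# + (tail ⊛ egf B) n                          ≈⟨ +-identityˡ _ ⟩
    (tail ⊛ egf B) n                               ≈⟨ ⊛-congʳ tail (egf-! z/[eᶻ-1]) n ⟩
    (tail ⊛ z/[eᶻ-1]) n                            ≈⟨ ⊘-spec one tail eᶻ-1₁#0 n ⟩
    one n                                          ∎
    where
    open SetoidReasoning setoid
    tail : Series
    tail n = μeᶻ-1 1# (suc n)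

  -- 0 is representable, so n ∸ 1 is a true predecessor for n in NR a b.
  S : ℕ → Carrier → (a b : ℕ) .{{_ : ℕ.NonZero a}} .{{_ : ℕ.NonZero b}} → Carrier
  S m ƛ a b = foldr _+_ 0# (map (λ n → ƛ ^ (n ∸ 1) * fromℕ n ^ m) (NR a b))

  private
    geometric : ℕ → Carrier → Carrier
    geometric zero    x = 0#
    geometric (suc n) x = 1# + x * geometric n x

    open NaturalSolver commutativeSemiring using (solve; con; _:+_; _:*_; _:=_)

    geometric-telescope : ∀ n x → x ^ n + geometric n x ≈ 1# + x * geometric n x
    geometric-telescope zero    x = +-congˡ (sym (zeroʳ x))
    geometric-telescope (suc n) x = begin
      x * x ^ n + (1# + x * geometric n x)    ≈⟨ solve 3 (λ x p g → x :* p :+ (con 1 :+ x :* g) := con 1 :+ x :* (p :+ g)) refl x (x ^ n) (geometric n x) ⟩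
      1# + x * (x ^ n + geometric n x)        ≈⟨ +-congˡ (*-congˡ (geometric-telescope n x)) ⟩
      1# + x * (1# + x * geometric n x)       ∎
      where open SetoidReasoning setoid

    x-1+1≈x : ∀ x → x - 1# + 1# ≈ x
    x-1+1≈x x = trans (+-assoc _ _ _) (trans (+-congˡ (-‿inverseˡ 1#)) (+-identityʳ x))

    -- xⁿ - 1 = (x - 1) (1 + x + … + xⁿ⁻¹)
    geometric-sum : ∀ n x → x ^ n - 1# ≈ (x - 1#) * geometric n x
    geometric-sum n x = +-cancelʳ (1# + g) _ _ (begin
      x ^ n - 1# + (1# + g)         ≈⟨ +-assoc _ _ _ ⟨
      x ^ n - 1# + 1# + g           ≈⟨ +-congʳ (x-1+1≈x (x ^ n)) ⟩
      x ^ n + g                     ≈⟨ geometric-telescope n x ⟩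
      1# + x * g                    ≈⟨ +-congˡ (*-congʳ (x-1+1≈x x)) ⟨
      1# + (x - 1# + 1#) * g        ≈⟨ solve 2 (λ u g → con 1 :+ (u :+ con 1) :* g := u :* g :+ (con 1 :+ g)) refl (x - 1#) g ⟩
      (x - 1#) * g + (1# + g)       ∎)
      where
      open SetoidReasoning setoid
      open RingProperties ring using (+-cancelʳ)
      g = geometric n x

    geometric-1 : ∀ n → geometric n 1# ≈ fromℕ n
    geometric-1 zero    = refl
    geometric-1 (suc n) = +-congˡ (trans (*-identityˡ _) (geometric-1 n))

    geometric-difference : ∀ n x → ∃[ d ] geometric n x ≈ geometric n 1# + (x - 1#) * d
    geometric-difference zero    x = 0# , sym (trans (+-identityˡ _) (zeroʳ _))
    geometric-difference (suc n) x with geometric-difference n x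
    ... | d , eq = x * d + geometric n 1# , (begin
      1# + x * geometric n x            ≈⟨ +-congˡ (*-congˡ eq) ⟩
      1# + x * (g + u * d)              ≈⟨ +-congˡ (*-congʳ (x-1+1≈x x)) ⟨
      1# + (u + 1#) * (g + u * d)       ≈⟨ solve 3 (λ u g d → con 1 :+ (u :+ con 1) :* (g :+ u :* d)
                                                     := con 1 :+ con 1 :* g :+ u :* ((u :+ con 1) :* d :+ g)) refl u g d ⟩
      1# + 1# * g + u * ((u + 1#) * d + g) ≈⟨ +-congˡ (*-congˡ (+-congʳ (*-congʳ (x-1+1≈x x)))) ⟩
      1# + 1# * g + u * (x * d + g)     ∎)
      where
      open SetoidReasoning setoid
      u = x - 1#
      g = geometric n 1#

  opaque
    root#0 : ∀ a .{{_ : ℕ.NonZero a}} {x} → x ^ a ≈ 1# → x # 0#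
    root#0 (suc a) = inverse⇒#0

    #1-root : ∀ n {x} → x ^ n # 1# → x # 1#
    #1-root n {x} xⁿ#1 = -#0⇒# (*-#0ˡ (#-congʳ (geometric-sum n x) (#⇒-#0 xⁿ#1)))

    -- A root of unity that is not equal to 1 is apart from 1, because 1 is
    -- a simple root of xᵃ - 1.
    root≉1⇒#1 : ∀ a .{{_ : ℕ.NonZero a}} {x} → x ^ a ≈ 1# → ¬ x ≈ 1# → x # 1#
    root≉1⇒#1 (suc n) {x} xᵃ≈1 x≉1 with geometric-difference (suc n) x
      | #-cotrans (#-congʳ (sym (geometric-1 (suc n))) (characteristic0 n)) (geometric (suc n) x)
    ... | d , eq | inj₁ 1#x = -#0⇒# (*-#0ˡ (#-congʳ eq′ (#⇒-#0 (#-sym 1#x))))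
      where
      eq′ : geometric (suc n) x - geometric (suc n) 1# ≈ (x - 1#) * d
      eq′ = trans (+-congʳ (trans eq (+-comm _ _))) (trans (+-assoc _ _ _)
              (trans (+-congˡ (-‿inverseʳ _)) (+-identityʳ _)))
    ... | _ | inj₂ g#0 = contradiction x≈1 x≉1
      where
      open SetoidReasoning setoid
      g : Carrier
      g = geometric (suc n) x
      x-1≈0 : x - 1# ≈ 0#
      x-1≈0 = begin
        x - 1#                          ≈⟨ *-identityʳ _ ⟨
        (x - 1#) * 1#                   ≈⟨ *-congˡ (inverseʳ g g#0) ⟨
        (x - 1#) * (g * inverse g g#0)  ≈⟨ *-assoc _ _ _ ⟨
        (x - 1#) * g * inverse g g#0    ≈⟨ *-congʳ (geometric-sum (suc n) x) ⟨
        (x ^ suc n - 1#) * inverse g g#0 ≈⟨ *-congʳ (trans (+-congʳ xᵃ≈1) (-‿inverseʳ 1#)) ⟩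
        0# * inverse g g#0              ≈⟨ zeroˡ _ ⟩
        0#                              ∎
      x≈1 : x ≈ 1#
      x≈1 = RingProperties.x∙y⁻¹≈ε⇒x≈y ring x 1# x-1≈0

    root^≉1⇒#1 : ∀ a b .{{_ : ℕ.NonZero a}} {x} → x ^ a ≈ 1# → ¬ x ^ b ≈ 1# → x ^ b # 1#
    root^≉1⇒#1 a b {x} xᵃ≈1 = root≉1⇒#1 a (begin
      (x ^ b) ^ a     ≈⟨ ^-assocʳ x b a ⟩
      x ^ (b ℕ.* a)   ≡⟨ ≡.cong (x ^_) (ℕₚ.*-comm b a) ⟩
      x ^ (a ℕ.* b)   ≈⟨ ^-assocʳ x a b ⟨
      (x ^ a) ^ b     ≈⟨ ^-congˡ b xᵃ≈1 ⟩
      1# ^ b          ≈⟨ 1^ b ⟩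
      1#              ∎)
      where
      open SetoidReasoning setoid
      1^ : ∀ n → 1# ^ n ≈ 1#
      1^ zero    = refl
      1^ (suc n) = trans (*-identityˡ _) (1^ n)

module ComplexNumbers = AdjoinI RealNumbers.heytingField RealNumbers.sumOfSquares#0

-- Opaque only for performance: otherwise comparing two complex numbers
-- η-expands them into expressions in their real and imaginary parts.
opaque
  ℂ-heytingField : HeytingField 0ℓ 0ℓ 0ℓ
  ℂ-heytingField = ComplexNumbers.heytingFieldᶜ

  ℂ-characteristic0 : FieldProperties.Characteristic0 ℂ-heytingField
  ℂ-characteristic0 = ComplexNumbers.characteristic0ᶜ RealNumbers.characteristic0

open HeytingField ℂ-heytingField public
  using (_≈_; _#_; _+_; _*_; _-_; 0#; 1#)
  renaming (Carrier to ℂ)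
open FieldProperties ℂ-heytingField public using (inverse)
open ApostolBernoulli ℂ-heytingField ℂ-characteristic0 public

{-# OPTIONS --safe #-}

-- Put w = ƛ exp z, so that wᵃ = exp(az) and w^(ab) = exp(abz) because ƛᵃ = 1.
-- A number n ≥ a is representable while n - a is not exactly when n = by with
-- y < a; comparing ∑ wⁿ over the nonrepresentable n with its shift by a gives
--   ∑ wⁿ = (w^(ab) - 1) / ((wᵃ - 1) (wᵇ - 1)) - 1 / (w - 1).
-- Multiplied by z, the right-hand side is the product of
-- (exp(abz) - 1) / (abz), az / (exp(az) - 1) and bz / (ƛᵇ exp(bz) - 1), minus
-- z / (ƛ exp z - 1); the theorem compares the coefficients of z^(m+1).
module Submission where

open import Algebra.Apartness.Bundles using (HeytingField; HeytingCommutativeRing)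
open import Algebra.Bundles using (CommutativeRing)
import Algebra.Construct.Pointwise as Pointwise
import Algebra.Properties.CommutativeSemiring.Binomial as Binomial
import Algebra.Properties.CommutativeSemiring.Exp as Exp
import Algebra.Properties.Ring as RingProperties
import Algebra.Properties.Semiring.Mult as SemiringMult
import Algebra.Properties.Semiring.Sum as SemiringSum
import Algebra.Solver.Ring.NaturalCoefficients.Default as NaturalSolver
open import Data.Fin.Base using (toℕ)
open import Data.List.Base using (map; foldr; filter; applyUpTo)
open import Data.Nat.Base as ℕ using (ℕ; zero; suc; _∸_; NonZero; _<_; _≤_; s≤s; z≤n; _!)
import Data.Nat.Properties as ℕₚ
open import Data.Nat.Combinatorics using (_C_; nCk≡n!/k![n-k]!; k![n∸k]!∣n!)
open import Data.Nat.Coprimality using (coprime-divisor; gcd≡1⇒coprime)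
open import Data.Nat.Divisibility using (divides; ∣⇒≤)
open import Data.Nat.DivMod using (m/n*n≡m)
open import Data.Nat.GCD using (gcd)
open import Data.Nat.Solver using () renaming (module +-*-Solver to ℕ-Solver)
open import Data.Product.Base using (∃-syntax; _×_; _,_)
open import Function.Base using (_∘_)
open import Relation.Binary.PropositionalEquality as ≡ using (_≡_; _≢_)
import Relation.Binary.Reasoning.Setoid as SetoidReasoning
open import Relation.Nullary using (¬_; Dec; yes; no; contradiction; ¬?)
open import Relation.Unary using (Pred; Decidable)
open import Defs using (module NumericalSemigroup; module FieldProperties; module PowerSeries; module ApostolBernoulli)
open NumericalSemigroup

-- The quotients of the overview cannot be formed literally: exp(az) - 1 has constant term 0, so it
-- is no unit among the power series. The identity is therefore proved with all denominators cleared
-- and multiplied by the Bernoulli series, which enter only through equations such as (exp z - 1)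
-- B(z) = z. The common factor ab z^2 is cancelled at the end: a and b are invertible in
-- characteristic 0, and multiplication by z merely shifts coefficients. Counting gaps needs ring
-- operations and finite sums only, so it is done over an arbitrary commutative ring. Over the power
-- series it is applied to w = ƛ exp z; over the field, the same indicator of the gaps expresses
-- `S`. The two meet because m! times the coefficient of z^m in exp(nz) is n^m.

-- Representable numbers and the Apéry set { by : y < a }

module _ {a b : ℕ} where

  representable-+ : ∀ {n} → Representable a b n → Representable a b (a ℕ.+ n)
  representable-+ (x , y , ≡.refl) = suc x , y ,
    solve 4 (λ a b x y → a :+ (a :* x :+ b :* y) := a :* (con 1 :+ x) :+ b :* y) ≡.refl a b x y
    where open ℕ-Solver

  representable-multiple : ∀ y → Representable a b (b ℕ.* y)
  representable-multiple y = 0 , y , ≡.cong (ℕ._+ b ℕ.* y) (≡.sym (ℕₚ.*-zeroʳ a))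

  representable-<⇒multiple : .{{_ : NonZero b}} → ∀ {n} → n < a → Representable a b n →
    ∃[ y ] y < a × n ≡ b ℕ.* y
  representable-<⇒multiple n<a (suc x , y , ≡.refl) = contradiction
    (ℕₚ.≤-trans (ℕₚ.m≤m*n a (suc x)) (ℕₚ.m≤m+n _ (b ℕ.* y))) (ℕₚ.<⇒≱ n<a)
  representable-<⇒multiple {n} n<a (zero , y , eq) = y ,
    ℕₚ.≤-<-trans (ℕₚ.≤-trans (ℕₚ.m≤n*m y b) (ℕₚ.≤-reflexive (≡.sym n≡by))) n<a , n≡by
    where
    n≡by : n ≡ b ℕ.* y
    n≡by = ≡.trans eq (≡.cong (ℕ._+ b ℕ.* y) (ℕₚ.*-zeroʳ a))

  -- A representation of a + n that uses a could drop one a and would represent n. One with y ≥ a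
  -- could trade a copies of b for b copies of a, and then drop one of these; this gives the witness
  -- `pred b , y ∸ a`.
  leastRepresentable⇒multiple : .{{_ : NonZero b}} → ∀ {n} →
    ¬ Representable a b n → Representable a b (a ℕ.+ n) → ∃[ y ] y < a × a ℕ.+ n ≡ b ℕ.* y
  leastRepresentable⇒multiple ¬rep (suc x , y , eq) = contradiction
    (x , y , ℕₚ.+-cancelˡ-≡ a _ _ (≡.trans eq (≡.trans
      (≡.cong (ℕ._+ b ℕ.* y) (ℕₚ.*-suc a x)) (ℕₚ.+-assoc a (a ℕ.* x) (b ℕ.* y))))) ¬rep
  leastRepresentable⇒multiple {n} ¬rep (zero , y , eq) with y ℕₚ.<? a
  ... | yes y<a = y , y<a , ≡.trans eq (≡.cong (ℕ._+ b ℕ.* y) (ℕₚ.*-zeroʳ a))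
  ... | no  y≮a = contradiction (ℕ.pred b , y ∸ a , ℕₚ.+-cancelˡ-≡ a _ _ (begin
    a ℕ.+ n                                            ≡⟨ eq ⟩
    a ℕ.* 0 ℕ.+ b ℕ.* y                                ≡⟨ ≡.cong (ℕ._+ b ℕ.* y) (ℕₚ.*-zeroʳ a) ⟩
    b ℕ.* y                                            ≡⟨ ≡.cong (b ℕ.*_) (ℕₚ.m+[n∸m]≡n (ℕₚ.≮⇒≥ y≮a)) ⟨
    b ℕ.* (a ℕ.+ (y ∸ a))                              ≡⟨ ℕₚ.*-distribˡ-+ b a (y ∸ a) ⟩
    b ℕ.* a ℕ.+ b ℕ.* (y ∸ a)                          ≡⟨ ≡.cong (λ t → t ℕ.* a ℕ.+ b ℕ.* (y ∸ a)) (ℕₚ.suc-pred b) ⟨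
    a ℕ.+ ℕ.pred b ℕ.* a ℕ.+ b ℕ.* (y ∸ a)             ≡⟨ ℕₚ.+-assoc a _ _ ⟩
    a ℕ.+ (ℕ.pred b ℕ.* a ℕ.+ b ℕ.* (y ∸ a))           ≡⟨ ≡.cong (λ t → a ℕ.+ (t ℕ.+ b ℕ.* (y ∸ a))) (ℕₚ.*-comm (ℕ.pred b) a) ⟩
    a ℕ.+ (a ℕ.* ℕ.pred b ℕ.+ b ℕ.* (y ∸ a))           ∎)) ¬rep
    where open ≡.≡-Reasoning

  -- If n = ax + by′, then (x + 1)a = b(y - y′), so by coprimality a divides y - y′. As this
  -- difference is positive, a ≤ y - y′ ≤ y < a, which is absurd.
  multiple⇒leastRepresentable : .{{_ : NonZero a}} .{{_ : NonZero b}} → gcd a b ≡ 1 →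
    ∀ {n y} → y < a → a ℕ.+ n ≡ b ℕ.* y → ¬ Representable a b n
  multiple⇒leastRepresentable gcd≡1 {y = y} y<a eq (x , y′ , ≡.refl) =
    ℕₚ.<⇒≱ y<a (ℕₚ.≤-trans a≤y-y′ (ℕₚ.m∸n≤m y y′))
    where
    open ≡.≡-Reasoning
    eq′ : suc x ℕ.* a ≡ b ℕ.* (y ∸ y′)
    eq′ = begin
      suc x ℕ.* a                                    ≡⟨ ℕₚ.m+n∸n≡m _ (b ℕ.* y′) ⟨
      suc x ℕ.* a ℕ.+ b ℕ.* y′ ∸ b ℕ.* y′            ≡⟨ ≡.cong (_∸ b ℕ.* y′) (≡.trans (ℕₚ.+-assoc a (x ℕ.* a) _)
                                                          (≡.trans (≡.cong (λ t → a ℕ.+ (t ℕ.+ b ℕ.* y′)) (ℕₚ.*-comm x a)) eq)) ⟩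
      b ℕ.* y ∸ b ℕ.* y′                             ≡⟨ ℕₚ.*-distribˡ-∸ b y y′ ⟨
      b ℕ.* (y ∸ y′)                                 ∎
    -- This also covers y < y′, where the truncated difference is 0.
    y-y′≢0 : y ∸ y′ ≢ 0
    y-y′≢0 y-y′≡0 = ℕ.≢-nonZero⁻¹ a (ℕₚ.m+n≡0⇒m≡0 a
      (≡.trans eq′ (≡.trans (≡.cong (b ℕ.*_) y-y′≡0) (ℕₚ.*-zeroʳ b))))
    a≤y-y′ : a ≤ y ∸ y′
    a≤y-y′ = ∣⇒≤ {{ℕ.≢-nonZero y-y′≢0}}
      (coprime-divisor (gcd≡1⇒coprime gcd≡1) (divides (suc x) (≡.sym eq′)))

-- Finite sums over a commutative ring

module RingSums {c ℓ} (R : CommutativeRing c ℓ) where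

  open CommutativeRing R
  open SemiringSum semiring
  open Exp commutativeSemiring using (_^_; ^-homo-*; ^-assocʳ)
  open NaturalSolver commutativeSemiring using (solve; con; _:+_; _:*_; _:=_)
  open RingProperties ring using (+-cancelʳ)
  open SetoidReasoning setoid

  sumBelow : ℕ → (ℕ → Carrier) → Carrier
  sumBelow n f = sum {n} (f ∘ toℕ)

  infixr 5 sumBelow
  syntax sumBelow n (λ k → x) = ∑[0≤ k < n ] x

  sumBelow-cong : ∀ n {f g} → (∀ {k} → k < n → f k ≈ g k) → sumBelow n f ≈ sumBelow n g
  sumBelow-cong zero    f≈g = refl
  sumBelow-cong (suc n) f≈g = +-cong (f≈g (s≤s z≤n)) (sumBelow-cong n (f≈g ∘ s≤s))

  sumBelow-zero : ∀ n f → (∀ {k} → k < n → f k ≈ 0#) → sumBelow n f ≈ 0#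
  sumBelow-zero n f f≈0 = trans (sumBelow-cong n f≈0) (sum-replicate-zero n)

  sumBelow-+ : ∀ m n f → sumBelow (m ℕ.+ n) f ≈ sumBelow m f + sumBelow n (f ∘ (m ℕ.+_))
  sumBelow-+ zero    n f = sym (+-identityˡ _)
  sumBelow-+ (suc m) n f = trans (+-congˡ (sumBelow-+ m n (f ∘ suc))) (sym (+-assoc _ _ _))

  sumBelow-single : ∀ n f {k} → k < n → (∀ {j} → j ≢ k → f j ≈ 0#) → sumBelow n f ≈ f k
  sumBelow-single (suc n) f {zero}  k<n f≈0 =
    trans (+-congˡ (sumBelow-zero n (f ∘ suc) (λ {k} _ → f≈0 {suc k} λ ()))) (+-identityʳ (f 0))
  sumBelow-single (suc n) f {suc k} k<n f≈0 =
    trans (+-cong (f≈0 {0} λ ()) (sumBelow-single n (f ∘ suc) (ℕ.s≤s⁻¹ k<n) (λ j≢k → f≈0 (j≢k ∘ ℕₚ.suc-injective))))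
      (+-identityˡ _)

  -- Stated for u = x - 1.
  geometric-sum : ∀ n {x u} → u + 1# ≈ x → u * (∑[0≤ k < n ] x ^ k) + 1# ≈ x ^ n
  geometric-sum zero    {x} {u} eq = trans (+-congʳ (zeroʳ u)) (+-identityˡ 1#)
  geometric-sum (suc n) {x} {u} eq = begin
    u * (1# + sumBelow n (λ k → x * x ^ k)) + 1#   ≈⟨ +-congʳ (*-congˡ (+-congˡ (*-distribˡ-sum {n} x (λ k → x ^ toℕ k)))) ⟨
    u * (1# + x * G) + 1#                          ≈⟨ solve 3 (λ u x g → u :* (con 1 :+ x :* g) :+ con 1 := (u :+ con 1) :+ x :* (u :* g)) refl u x G ⟩
    (u + 1#) + x * (u * G)                         ≈⟨ +-congʳ eq ⟩
    x + x * (u * G)                                ≈⟨ solve 2 (λ x v → x :+ x :* v := x :* (v :+ con 1)) refl x (u * G) ⟩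
    x * (u * G + 1#)                               ≈⟨ *-congˡ (geometric-sum n eq) ⟩
    x * x ^ n                                      ∎
    where
    G : Carrier
    G = sumBelow n (x ^_)

  -- The Iverson bracket.
  ⟦_⟧ : ∀ {p} {P : Set p} → Dec P → Carrier
  ⟦ yes _ ⟧ = 1#
  ⟦ no  _ ⟧ = 0#

  ⟦⟧-yes : ∀ {p} {P : Set p} (P? : Dec P) → P → ⟦ P? ⟧ ≈ 1#
  ⟦⟧-yes (yes _) p = refl
  ⟦⟧-yes (no ¬p) p = contradiction p ¬p

  ⟦⟧-no : ∀ {p} {P : Set p} (P? : Dec P) → ¬ P → ⟦ P? ⟧ ≈ 0#
  ⟦⟧-no (yes p) ¬p = contradiction p ¬p
  ⟦⟧-no (no _)  ¬p = refl

  -- `h` is arbitrary for the sake of the induction: the tail of `applyUpTo h` is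
  -- `applyUpTo (h ∘ suc)`.
  sum-filter : ∀ {p} {P : Pred ℕ p} (P? : Decidable P) (g : ℕ → Carrier) (h : ℕ → ℕ) n →
    foldr _+_ 0# (map g (filter P? (applyUpTo h n))) ≈ ∑[0≤ k < n ] ⟦ P? (h k) ⟧ * g (h k)
  sum-filter P? g h zero    = refl
  sum-filter P? g h (suc n) with P? (h 0)
  ... | yes _ = +-cong (sym (*-identityˡ _)) (sum-filter P? g (h ∘ suc) n)
  ... | no  _ = trans (sum-filter P? g (h ∘ suc) n) (sym (trans (+-congʳ (zeroˡ _)) (+-identityˡ _)))

  -- The generating polynomial of the gaps

  module _ (a b : ℕ) .{{_ : NonZero a}} .{{_ : NonZero b}} (gcd≡1 : gcd a b ≡ 1) where

    opaque
      gap : ℕ → Carrier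
      gap n = ⟦ ¬? (representable? a b n) ⟧

      -- The indicator of the Apéry set: at most one bracket is 1, because b is nonzero. Written as
      -- a sum over y, it lets `sum-isMultiple` be an exchange of two summations.
      isMultiple : ℕ → Carrier
      isMultiple n = ∑[0≤ y < a ] ⟦ n ℕₚ.≟ b ℕ.* y ⟧

      gap-yes : ∀ {n} → ¬ Representable a b n → gap n ≈ 1#
      gap-yes {n} ¬rep = ⟦⟧-yes (¬? (representable? a b n)) ¬rep

      gap-no : ∀ {n} → ¬ ¬ Representable a b n → gap n ≈ 0#
      gap-no {n} ¬¬rep = ⟦⟧-no (¬? (representable? a b n)) ¬¬rep

      isMultiple-yes : ∀ {n y} → y < a → n ≡ b ℕ.* y → isMultiple n ≈ 1#
      isMultiple-yes {n} {y} y<a ≡.refl = trans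
        (sumBelow-single a (λ j → ⟦ b ℕ.* y ℕₚ.≟ b ℕ.* j ⟧) y<a
          (λ {j} j≢y → ⟦⟧-no (b ℕ.* y ℕₚ.≟ b ℕ.* j) (λ eq → j≢y (≡.sym (ℕₚ.*-cancelˡ-≡ y j b eq)))))
        (⟦⟧-yes (b ℕ.* y ℕₚ.≟ b ℕ.* y) ≡.refl)

      isMultiple-no : ∀ {n} → (∀ {y} → y < a → n ≢ b ℕ.* y) → isMultiple n ≈ 0#
      isMultiple-no {n} n≢by = sumBelow-zero a (λ y → ⟦ n ℕₚ.≟ b ℕ.* y ⟧)
        (λ {y} y<a → ⟦⟧-no (n ℕₚ.≟ b ℕ.* y) (n≢by y<a))

      sum-NR : ∀ (g : ℕ → Carrier) →
        foldr _+_ 0# (map g (NR a b)) ≈ ∑[0≤ n < a ℕ.* b ] gap n * g n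
      sum-NR g = sum-filter (λ n → ¬? (representable? a b n)) g (λ n → n) (a ℕ.* b)

      sum-isMultiple : ∀ {m} → a ℕ.* b ≤ m → ∀ w →
        (∑[0≤ n < m ] isMultiple n * w ^ n) ≈ ∑[0≤ y < a ] (w ^ b) ^ y
      sum-isMultiple {m} ab≤m w = begin
        (∑[0≤ n < m ] isMultiple n * w ^ n)
          ≈⟨ sumBelow-cong m (λ {n} _ → *-distribʳ-sum {a} (w ^ n) (λ y → ⟦ n ℕₚ.≟ b ℕ.* toℕ y ⟧)) ⟩
        (∑[0≤ n < m ] ∑[0≤ y < a ] f n y)
          ≈⟨ ∑-comm {m} {a} (λ n y → f (toℕ n) (toℕ y)) ⟩
        (∑[0≤ y < a ] ∑[0≤ n < m ] f n y)
          ≈⟨ sumBelow-cong a single ⟩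
        (∑[0≤ y < a ] (w ^ b) ^ y) ∎
        where
        f : ℕ → ℕ → Carrier
        f n y = ⟦ n ℕₚ.≟ b ℕ.* y ⟧ * w ^ n
        single : ∀ {y} → y < a → (∑[0≤ n < m ] f n y) ≈ (w ^ b) ^ y
        single {y} y<a = begin
          (∑[0≤ n < m ] f n y)    ≈⟨ sumBelow-single m (λ n → f n y) by<m (λ {n} n≢by → trans (*-congʳ (⟦⟧-no (n ℕₚ.≟ b ℕ.* y) n≢by)) (zeroˡ _)) ⟩
          f (b ℕ.* y) y           ≈⟨ *-congʳ (⟦⟧-yes (b ℕ.* y ℕₚ.≟ b ℕ.* y) ≡.refl) ⟩
          1# * w ^ (b ℕ.* y)      ≈⟨ *-identityˡ _ ⟩
          w ^ (b ℕ.* y)           ≈⟨ ^-assocʳ w b y ⟨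
          (w ^ b) ^ y             ∎
          where
          by<m : b ℕ.* y < m
          by<m = ℕₚ.<-≤-trans (ℕₚ.*-monoʳ-< b y<a) (ℕₚ.≤-trans (ℕₚ.≤-reflexive (ℕₚ.*-comm b a)) ab≤m)

    -- The case of `gap-shift` in which n - a would be negative, hence counts as nonrepresentable.
    gap-below : ∀ {n} → n < a → 1# ≈ gap n + isMultiple n
    gap-below {n} n<a = sym (case (representable? a b n))
      where
      case : Dec (Representable a b n) → gap n + isMultiple n ≈ 1#
      case (yes rep) with representable-<⇒multiple {a} {b} n<a rep
      ... | y , y<a , eq = trans (+-cong (gap-no (λ ¬rep → ¬rep rep)) (isMultiple-yes y<a eq)) (+-identityˡ 1#)
      case (no ¬rep) = trans
        (+-cong (gap-yes ¬rep) (isMultiple-no (λ { {y} _ ≡.refl → ¬rep (representable-multiple {a} {b} y) })))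
        (+-identityʳ 1#)

    -- Adding a never destroys representability, and it creates it exactly when a + n lies in the
    -- Apéry set.
    gap-shift : ∀ n → gap n ≈ gap (a ℕ.+ n) + isMultiple (a ℕ.+ n)
    gap-shift n with representable? a b n
    ... | yes rep = trans (gap-no (λ ¬rep → ¬rep rep)) (sym (trans
            (+-cong (gap-no (λ ¬rep → ¬rep (representable-+ {a} {b} rep)))
              (isMultiple-no (λ y<a eq → multiple⇒leastRepresentable {a} {b} gcd≡1 y<a eq rep)))
            (+-identityˡ 0#)))
    ... | no ¬rep = trans (gap-yes ¬rep) (sym (case (representable? a b (a ℕ.+ n))))
      where
      case : Dec (Representable a b (a ℕ.+ n)) → gap (a ℕ.+ n) + isMultiple (a ℕ.+ n) ≈ 1#
      case (yes rep′) with leastRepresentable⇒multiple {a} {b} ¬rep rep′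
      ... | y , y<a , eq = trans (+-cong (gap-no (λ ¬rep → ¬rep rep′)) (isMultiple-yes y<a eq)) (+-identityˡ 1#)
      case (no ¬rep′) = trans
        (+-cong (gap-yes ¬rep′) (isMultiple-no (λ {y} _ eq →
          ¬rep′ (≡.subst (Representable a b) (≡.sym eq) (representable-multiple {a} {b} y)))))
        (+-identityʳ 1#)

    gapSum : Carrier → Carrier
    gapSum w = ∑[0≤ n < a ℕ.* b ] gap n * w ^ n

    gapSum-extend : ∀ m w → (∑[0≤ n < a ℕ.* b ℕ.+ m ] gap n * w ^ n) ≈ gapSum w
    gapSum-extend m w = trans (sumBelow-+ (a ℕ.* b) m f) (trans
      (+-congˡ (sumBelow-zero m (f ∘ (a ℕ.* b ℕ.+_)) (λ {n} _ → trans
        (*-congʳ (gap-no (λ ¬rep → ℕₚ.m+n≮m (a ℕ.* b) n (nonrepresentable⇒<a*b a b gcd≡1 ¬rep))))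
        (zeroˡ _))))
      (+-identityʳ _))
      where
      f : ℕ → Carrier
      f n = gap n * w ^ n

    -- Both sides evaluate the sum of `(gap n + isMultiple n) * w ^ n` over n < ab + a. On the left
    -- it is split at a, with `gap-below` before and `gap-shift` after; on the right it is split
    -- into its two summands, and the gaps stop below ab.
    gapSum-recurrence : ∀ w →
      (∑[0≤ n < a ] w ^ n) + w ^ a * gapSum w ≈ gapSum w + (∑[0≤ y < a ] (w ^ b) ^ y)
    gapSum-recurrence w = begin
      (∑[0≤ n < a ] w ^ n) + w ^ a * gapSum w
        ≈⟨ +-cong (sumBelow-cong a below) (trans (*-distribˡ-sum {a ℕ.* b} (w ^ a) (λ n → gap (toℕ n) * w ^ toℕ n))
             (sumBelow-cong (a ℕ.* b) (λ {n} _ → shift n))) ⟩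
      sumBelow a f + sumBelow (a ℕ.* b) (f ∘ (a ℕ.+_))
        ≈⟨ sumBelow-+ a (a ℕ.* b) f ⟨
      sumBelow (a ℕ.+ a ℕ.* b) f
        ≡⟨ ≡.cong (λ m → sumBelow m f) (ℕₚ.+-comm a (a ℕ.* b)) ⟩
      sumBelow (a ℕ.* b ℕ.+ a) f
        ≈⟨ sumBelow-cong (a ℕ.* b ℕ.+ a) (λ {n} _ → distribʳ (w ^ n) (gap n) (isMultiple n)) ⟩
      (∑[0≤ n < a ℕ.* b ℕ.+ a ] gap n * w ^ n + isMultiple n * w ^ n)
        ≈⟨ ∑-distrib-+ {a ℕ.* b ℕ.+ a} (λ n → gap (toℕ n) * w ^ toℕ n) (λ n → isMultiple (toℕ n) * w ^ toℕ n) ⟩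
      (∑[0≤ n < a ℕ.* b ℕ.+ a ] gap n * w ^ n) + (∑[0≤ n < a ℕ.* b ℕ.+ a ] isMultiple n * w ^ n)
        ≈⟨ +-cong (gapSum-extend a w) (sum-isMultiple (ℕₚ.m≤m+n (a ℕ.* b) a) w) ⟩
      gapSum w + (∑[0≤ y < a ] (w ^ b) ^ y) ∎
      where
      f : ℕ → Carrier
      f n = (gap n + isMultiple n) * w ^ n
      below : ∀ {n} → n < a → w ^ n ≈ f n
      below n<a = trans (sym (*-identityˡ _)) (*-congʳ (gap-below n<a))
      shift : ∀ n → w ^ a * (gap n * w ^ n) ≈ f (a ℕ.+ n)
      shift n = begin
        w ^ a * (gap n * w ^ n)    ≈⟨ solve 3 (λ x g y → x :* (g :* y) := g :* (x :* y)) refl (w ^ a) (gap n) (w ^ n) ⟩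
        gap n * (w ^ a * w ^ n)    ≈⟨ *-cong (gap-shift n) (sym (^-homo-* w a n)) ⟩
        f (a ℕ.+ n)                ∎

    -- With L = w - 1, A = wᵃ - 1, M = wᵇ - 1 and Q = wᵃᵇ - 1 this is
    -- ∑ wⁿ = Q / (A M) - 1 / L with denominators cleared.
    gapSum-identity : ∀ {w L A M Q} → L + 1# ≈ w → A + 1# ≈ w ^ a → M + 1# ≈ w ^ b → Q + 1# ≈ (w ^ b) ^ a →
      gapSum w * L * A * M + A * M ≈ Q * L
    gapSum-identity {w} {L} {A} {M} {Q} eL eA eM eQ = begin
      N * L * A * M + A * M      ≈⟨ +-congˡ (*-congʳ LG≈A) ⟨
      N * L * A * M + L * G * M  ≈⟨ solve 5 (λ n l a m g → n :* l :* a :* m :+ l :* g :* m := m :* (g :+ a :* n) :* l) refl N L A M G ⟩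
      M * (G + A * N) * L        ≈⟨ *-congʳ (*-congˡ G+AN≈H) ⟩
      M * H * L                  ≈⟨ *-congʳ MH≈Q ⟩
      Q * L                      ∎
      where
      N G H : Carrier
      N = gapSum w
      G = ∑[0≤ n < a ] w ^ n
      H = ∑[0≤ y < a ] (w ^ b) ^ y
      LG≈A : L * G ≈ A
      LG≈A = +-cancelʳ 1# _ _ (trans (geometric-sum a eL) (sym eA))
      MH≈Q : M * H ≈ Q
      MH≈Q = +-cancelʳ 1# _ _ (trans (geometric-sum a eM) (sym eQ))
      G+AN≈H : G + A * N ≈ H
      G+AN≈H = +-cancelʳ N _ _ (begin
        G + A * N + N            ≈⟨ solve 3 (λ g a n → g :+ a :* n :+ n := g :+ (a :+ con 1) :* n) refl G A N ⟩
        G + (A + 1#) * N         ≈⟨ +-congˡ (*-congʳ eA) ⟩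
        G + w ^ a * N            ≈⟨ gapSum-recurrence w ⟩
        N + H                    ≈⟨ +-comm N H ⟩
        H + N                    ∎)

    -- `gapSum-identity` multiplied by β γ δ. Each of L, A, M meets its partner and becomes a
    -- multiple of z, so no division occurs; the factor α μ z² stays on both sides, since it need
    -- not be cancellable in a general ring.
    gapSum-cleared : ∀ {w L A M Q z β γ δ κ α μ} →
      L + 1# ≈ w → A + 1# ≈ w ^ a → M + 1# ≈ w ^ b → Q + 1# ≈ (w ^ b) ^ a →
      L * δ ≈ z → A * β ≈ α * z → M * γ ≈ μ * z → Q ≈ α * μ * (z * κ) →
      α * μ * (z * (z * (z * gapSum w + δ))) ≈ α * μ * (z * (z * (β * γ * κ)))
    gapSum-cleared {w} {L} {A} {M} {Q} {z} {β} {γ} {δ} {κ} {α} {μ} eL eA eM eQ Lδ Aβ Mγ Qκ = begin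
      α * μ * (z * (z * (z * N + δ)))
        ≈⟨ solve 5 (λ α μ z n δ → α :* μ :* (z :* (z :* (z :* n :+ δ)))
                      := n :* z :* (α :* z) :* (μ :* z) :+ α :* z :* (μ :* z) :* δ) refl α μ z N δ ⟩
      N * z * (α * z) * (μ * z) + α * z * (μ * z) * δ
        ≈⟨ +-cong (*-cong (*-cong (*-congˡ Lδ) Aβ) Mγ) (*-congʳ (*-cong Aβ Mγ)) ⟨
      N * (L * δ) * (A * β) * (M * γ) + A * β * (M * γ) * δ
        ≈⟨ solve 7 (λ n l a m β γ δ → n :* (l :* δ) :* (a :* β) :* (m :* γ) :+ a :* β :* (m :* γ) :* δ
                      := (n :* l :* a :* m :+ a :* m) :* (β :* γ :* δ)) refl N L A M β γ δ ⟩
      (N * L * A * M + A * M) * (β * γ * δ)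
        ≈⟨ *-congʳ (gapSum-identity eL eA eM eQ) ⟩
      Q * L * (β * γ * δ)
        ≈⟨ solve 5 (λ q l β γ δ → q :* l :* (β :* γ :* δ) := q :* (l :* δ) :* (β :* γ)) refl Q L β γ δ ⟩
      Q * (L * δ) * (β * γ)
        ≈⟨ *-congʳ (*-cong Qκ Lδ) ⟩
      α * μ * (z * κ) * z * (β * γ)
        ≈⟨ solve 5 (λ α μ z κ ρ → α :* μ :* (z :* κ) :* z :* ρ := α :* μ :* (z :* (z :* (ρ :* κ)))) refl α μ z κ (β * γ) ⟩
      α * μ * (z * (z * (β * γ * κ))) ∎
      where
      N : Carrier
      N = gapSum w

-- The commutative ring of formal power series

module SeriesRing {c ℓ₁ ℓ₂} (F : HeytingField c ℓ₁ ℓ₂) where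

  open HeytingField F
  open HeytingCommutativeRing heytingCommutativeRing using (commutativeRing)
  open CommutativeRing commutativeRing using (semiring; commutativeSemiring)
  open PowerSeries F
  open SemiringSum semiring using (sum-cong-≋; ∑-distrib-+; *-distribˡ-sum; sum-replicate-zero)
  open NaturalSolver commutativeSemiring using (solve; con; _:+_; _:*_; _:=_)
  open SetoidReasoning setoid

  infix 4 _≋_

  _≋_ : Series → Series → Set ℓ₁
  f ≋ g = ∀ n → f n ≈ g n

  infixl 6 _⊕_

  _⊕_ : Series → Series → Series
  (f ⊕ g) n = f n + g n

  0ₛ : Series
  0ₛ n = 0#

  const : Carrier → Series
  const x n = x * one n

  ⊛-cong : ∀ {f f′ g g′} → f ≋ f′ → g ≋ g′ → f ⊛ g ≋ f′ ⊛ g′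
  ⊛-cong f≋f′ g≋g′ n = sum-cong-≋ {suc n} (λ k → *-cong (f≋f′ (toℕ k)) (g≋g′ (n ∸ toℕ k)))

  ⊛-distribˡ : ∀ f g h → f ⊛ (g ⊕ h) ≋ f ⊛ g ⊕ f ⊛ h
  ⊛-distribˡ f g h n = trans
    (sum-cong-≋ {suc n} (λ k → distribˡ (f (toℕ k)) (g (n ∸ toℕ k)) (h (n ∸ toℕ k))))
    (∑-distrib-+ {suc n} (λ k → f (toℕ k) * g (n ∸ toℕ k)) (λ k → f (toℕ k) * h (n ∸ toℕ k)))

  ⊛-distribʳ : ∀ f g h → (g ⊕ h) ⊛ f ≋ g ⊛ f ⊕ h ⊛ f
  ⊛-distribʳ f g h n = trans
    (sum-cong-≋ {suc n} (λ k → distribʳ (f (n ∸ toℕ k)) (g (toℕ k)) (h (toℕ k))))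
    (∑-distrib-+ {suc n} (λ k → g (toℕ k) * f (n ∸ toℕ k)) (λ k → h (toℕ k) * f (n ∸ toℕ k)))

  *-⊛ : ∀ x f g n → ((x *_) ∘ f ⊛ g) n ≈ x * (f ⊛ g) n
  *-⊛ x f g n = trans (sum-cong-≋ {suc n} (λ k → *-assoc x (f (toℕ k)) (g (n ∸ toℕ k))))
    (sym (*-distribˡ-sum {suc n} x (λ k → f (toℕ k) * g (n ∸ toℕ k))))

  ⊛-zeroˡ : ∀ f → 0ₛ ⊛ f ≋ 0ₛ
  ⊛-zeroˡ f n = trans (sum-cong-≋ {suc n} (λ k → zeroˡ (f (n ∸ toℕ k)))) (sum-replicate-zero (suc n))

  ⊛-identityˡ : ∀ f → one ⊛ f ≋ f
  ⊛-identityˡ f zero    = trans (+-identityʳ _) (*-identityˡ _)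
  ⊛-identityˡ f (suc n) = trans (+-cong (*-identityˡ _) (⊛-zeroˡ f n)) (+-identityʳ _)

  const-⊛ : ∀ x f n → (const x ⊛ f) n ≈ x * f n
  const-⊛ x f n = trans (*-⊛ x one f n) (*-congˡ (⊛-identityˡ f n))

  var-⊛ : ∀ f n → (var ⊛ f) (suc n) ≈ f n
  var-⊛ f n = trans (+-congʳ (zeroˡ _)) (trans (+-identityˡ _) (⊛-identityˡ f n))

  var-⊛-cancel : ∀ {f g} → var ⊛ f ≋ var ⊛ g → f ≋ g
  var-⊛-cancel {f} {g} eq n = trans (sym (var-⊛ f n)) (trans (eq (suc n)) (var-⊛ g n))

  -- Induction on the index replaces the reindexing of a double sum: by computation, the shift of
  -- `f ⊛ g` is `(f 0 *_) ∘ g ∘ suc ⊕ (f ∘ suc) ⊛ g`.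
  ⊛-assoc : ∀ f g h → (f ⊛ g) ⊛ h ≋ f ⊛ (g ⊛ h)
  ⊛-assoc f g h zero    = +-congʳ (begin
    (f 0 * g 0 + 0#) * h 0    ≈⟨ *-congʳ (+-identityʳ _) ⟩
    f 0 * g 0 * h 0           ≈⟨ *-assoc _ _ _ ⟩
    f 0 * (g 0 * h 0)         ≈⟨ *-congˡ (+-identityʳ _) ⟨
    f 0 * (g 0 * h 0 + 0#)    ∎)
  ⊛-assoc f g h (suc n) = begin
    (f 0 * g 0 + 0#) * h (suc n) + (((f 0 *_) ∘ g ∘ suc ⊕ (f ∘ suc) ⊛ g) ⊛ h) n
      ≈⟨ +-cong (*-congʳ (+-identityʳ _)) (⊛-distribʳ h ((f 0 *_) ∘ g ∘ suc) ((f ∘ suc) ⊛ g) n) ⟩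
    f 0 * g 0 * h (suc n) + (((f 0 *_) ∘ g ∘ suc ⊛ h) n + ((f ∘ suc) ⊛ g ⊛ h) n)
      ≈⟨ +-congˡ (+-cong (*-⊛ (f 0) (g ∘ suc) h n) (⊛-assoc (f ∘ suc) g h n)) ⟩
    f 0 * g 0 * h (suc n) + (f 0 * ((g ∘ suc) ⊛ h) n + ((f ∘ suc) ⊛ (g ⊛ h)) n)
      ≈⟨ solve 5 (λ x y z u v → x :* y :* z :+ (x :* u :+ v) := x :* (y :* z :+ u) :+ v) refl
           (f 0) (g 0) (h (suc n)) (((g ∘ suc) ⊛ h) n) (((f ∘ suc) ⊛ (g ⊛ h)) n) ⟩
    f 0 * (g ⊛ h) (suc n) + ((f ∘ suc) ⊛ (g ⊛ h)) n ∎

  -- A sum unfolds only at its first term. Commuting the tail brings the last term to the front, so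
  -- both end terms can be exchanged; this consumes two indices, whence the two base cases.
  ⊛-comm : ∀ f g → f ⊛ g ≋ g ⊛ f
  ⊛-comm f g zero          = +-congʳ (*-comm (f 0) (g 0))
  ⊛-comm f g (suc zero)    = solve 4 (λ x y z w → x :* y :+ (z :* w :+ con 0) := w :* z :+ (y :* x :+ con 0)) refl (f 0) (g 1) (f 1) (g 0)
  ⊛-comm f g (suc (suc n)) = begin
    f 0 * g (suc (suc n)) + ((f ∘ suc) ⊛ g) (suc n)
      ≈⟨ +-congˡ (⊛-comm (f ∘ suc) g (suc n)) ⟩
    f 0 * g (suc (suc n)) + (g 0 * f (suc (suc n)) + ((g ∘ suc) ⊛ (f ∘ suc)) n)
      ≈⟨ +-congˡ (+-congˡ (⊛-comm (g ∘ suc) (f ∘ suc) n)) ⟩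
    f 0 * g (suc (suc n)) + (g 0 * f (suc (suc n)) + ((f ∘ suc) ⊛ (g ∘ suc)) n)
      ≈⟨ solve 3 (λ x y z → x :+ (y :+ z) := y :+ (x :+ z)) refl _ _ _ ⟩
    g 0 * f (suc (suc n)) + (f ⊛ (g ∘ suc)) (suc n)
      ≈⟨ +-congˡ (⊛-comm f (g ∘ suc) (suc n)) ⟩
    g 0 * f (suc (suc n)) + ((g ∘ suc) ⊛ f) (suc n) ∎

  seriesRing : CommutativeRing c ℓ₁
  seriesRing = record
    { Carrier = Series
    ; _≈_ = _≋_
    ; _+_ = _⊕_
    ; _*_ = _⊛_
    ; -_  = λ f n → - f n
    ; 0#  = 0ₛ
    ; 1#  = one
    ; isCommutativeRing = record
      { isRing = record
        { +-isAbelianGroup = Pointwise.isAbelianGroup ℕ +-isAbelianGroup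
        ; *-cong     = ⊛-cong
        ; *-assoc    = ⊛-assoc
        ; *-identity = ⊛-identityˡ , λ f n → trans (⊛-comm f one n) (⊛-identityˡ f n)
        ; distrib    = ⊛-distribˡ , ⊛-distribʳ
        }
      ; *-comm = ⊛-comm
      }
    }

-- Exponential series and substitution

module GapSums {c ℓ₁ ℓ₂} (F : HeytingField c ℓ₁ ℓ₂)
  (characteristic0 : FieldProperties.Characteristic0 F)
  where

  open HeytingField F
  open HeytingCommutativeRing heytingCommutativeRing using (commutativeRing)
  open CommutativeRing commutativeRing using (semiring; commutativeSemiring)
  open ApostolBernoulli F characteristic0
  open SeriesRing F
  open FieldProperties F using (_·_)
  open SemiringSum semiring using (*-distribˡ-sum; *-distribʳ-sum)
  open SemiringMult semiring using (×1-homo-*; ×-assoc-*; ×-congʳ)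
  open Exp commutativeSemiring using (^-homo-*; ^-distrib-*)
  open NaturalSolver commutativeSemiring using (solve; con; _:+_; _:*_; _:=_)
  open RingSums commutativeRing
  open SetoidReasoning setoid
  module 𝕊 = CommutativeRing seriesRing
  module Σ𝕊 = RingSums seriesRing
  open Exp 𝕊.commutativeSemiring using () renaming (_^_ to _^ₛ_; ^-assocʳ to ^ₛ-assocʳ)

  inverse-unique : ∀ {x y z} → x * y ≈ 1# → x * z ≈ 1# → y ≈ z
  inverse-unique {x} {y} {z} xy≈1 xz≈1 = begin
    y              ≈⟨ *-identityʳ y ⟨
    y * 1#         ≈⟨ *-congˡ xz≈1 ⟨
    y * (x * z)    ≈⟨ solve 3 (λ x y z → y :* (x :* z) := x :* y :* z) refl x y z ⟩
    x * y * z      ≈⟨ *-congʳ xy≈1 ⟩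
    1# * z         ≈⟨ *-identityˡ z ⟩
    z              ∎

  1/ℕ*fromℕ*x≈x : ∀ n .{{_ : NonZero n}} x → 1/ℕ n * (fromℕ n * x) ≈ x
  1/ℕ*fromℕ*x≈x n x = trans (sym (*-assoc _ _ _))
    (trans (*-congʳ (trans (*-comm _ _) (fromℕ*1/ℕ n))) (*-identityˡ x))

  fromℕ-cancel : ∀ n .{{_ : NonZero n}} {x y} → fromℕ n * x ≈ fromℕ n * y → x ≈ y
  fromℕ-cancel n {x} {y} eq =
    trans (sym (1/ℕ*fromℕ*x≈x n x)) (trans (*-congˡ eq) (1/ℕ*fromℕ*x≈x n y))

  1/ℕ-* : ∀ m n .{{_ : NonZero m}} .{{_ : NonZero n}} .{{_ : NonZero (m ℕ.* n)}} →
    1/ℕ (m ℕ.* n) ≈ 1/ℕ m * 1/ℕ n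
  1/ℕ-* m n = inverse-unique (fromℕ*1/ℕ (m ℕ.* n)) (begin
    fromℕ (m ℕ.* n) * (1/ℕ m * 1/ℕ n)        ≈⟨ *-congʳ (×1-homo-* m n) ⟩
    fromℕ m * fromℕ n * (1/ℕ m * 1/ℕ n)      ≈⟨ solve 4 (λ x y z w → x :* y :* (z :* w) := x :* z :* (y :* w)) refl _ _ _ _ ⟩
    fromℕ m * 1/ℕ m * (fromℕ n * 1/ℕ n)      ≈⟨ *-cong (fromℕ*1/ℕ m) (fromℕ*1/ℕ n) ⟩
    1# * 1#                                  ≈⟨ *-identityˡ 1# ⟩
    1#                                       ∎)

  !*1/! : ∀ n → fromℕ (n !) * 1/[ n !] ≈ 1#
  !*1/! n = fromℕ*1/ℕ (n !) {{n ℕₚ.!≢0}}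

  1/[1+n]! : ∀ n → 1/[ suc n !] ≈ 1/ℕ (suc n) * 1/[ n !]
  1/[1+n]! n = 1/ℕ-* (suc n) (n !) {{_}} {{n ℕₚ.!≢0}} {{suc n ℕₚ.!≢0}}

  fromℕ-C : ∀ {n k} → k ≤ n → fromℕ (n C k) ≈ fromℕ (n !) * (1/[ k !] * 1/[ n ∸ k !])
  fromℕ-C {n} {k} k≤n = begin
    fromℕ (n C k)
      ≈⟨ *-identityʳ _ ⟨
    fromℕ (n C k) * 1#
      ≈⟨ *-congˡ (trans (*-cong (!*1/! k) (!*1/! (n ∸ k))) (*-identityˡ 1#)) ⟨
    fromℕ (n C k) * (fromℕ (k !) * 1/[ k !] * (fromℕ ((n ∸ k) !) * 1/[ n ∸ k !]))
      ≈⟨ solve 5 (λ c x y z w → c :* (x :* y :* (z :* w)) := c :* (x :* z) :* (y :* w)) refl _ _ _ _ _ ⟩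
    fromℕ (n C k) * (fromℕ (k !) * fromℕ ((n ∸ k) !)) * (1/[ k !] * 1/[ n ∸ k !])
      ≈⟨ *-congʳ (trans (*-congˡ (sym (×1-homo-* (k !) ((n ∸ k) !)))) (sym (×1-homo-* (n C k) _))) ⟩
    fromℕ ((n C k) ℕ.* (k ! ℕ.* (n ∸ k) !)) * (1/[ k !] * 1/[ n ∸ k !])
      ≡⟨ ≡.cong (λ t → fromℕ t * (1/[ k !] * 1/[ n ∸ k !])) nCk*k!*[n∸k]!≡n! ⟩
    fromℕ (n !) * (1/[ k !] * 1/[ n ∸ k !]) ∎
    where
    nCk*k!*[n∸k]!≡n! : (n C k) ℕ.* (k ! ℕ.* (n ∸ k) !) ≡ n !
    nCk*k!*[n∸k]!≡n! = ≡.trans (≡.cong (ℕ._* (k ! ℕ.* (n ∸ k) !)) (nCk≡n!/k![n-k]! k≤n))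
      (m/n*n≡m {{k ℕₚ.!* (n ∸ k) !≢0}} (k![n∸k]!∣n! k≤n))

  -- The series of μ exp(x z).
  exp : Carrier → Carrier → Series
  exp μ x n = μ * (x ^ n * 1/[ n !])

  exp-cong : ∀ {μ ν x y} → μ ≈ ν → x ≈ y → exp μ x ≋ exp ν y
  exp-cong μ≈ν x≈y n = *-cong μ≈ν (*-congʳ (^-congˡ n x≈y))

  -- In each degree n this is the binomial theorem divided by `n !`.
  exp-⊛ : ∀ μ ν x y → exp μ x ⊛ exp ν y ≋ exp (μ * ν) (x + y)
  exp-⊛ μ ν x y n = begin
    (∑[0≤ k ≤ n ] (exp μ x k * exp ν y (n ∸ k)))
      ≈⟨ sumBelow-cong (suc n) term ⟩
    sumUpTo n (λ k → μ * ν * 1/[ n !] * ((n C k) · (x ^ k * y ^ (n ∸ k))))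
      ≈⟨ *-distribˡ-sum {suc n} (μ * ν * 1/[ n !]) (λ k → (n C toℕ k) · (x ^ toℕ k * y ^ (n ∸ toℕ k))) ⟨
    μ * ν * 1/[ n !] * sumUpTo n (λ k → (n C k) · (x ^ k * y ^ (n ∸ k)))
      ≈⟨ *-congˡ (Binomial.theorem commutativeSemiring n x y) ⟨
    μ * ν * 1/[ n !] * (x + y) ^ n
      ≈⟨ solve 3 (λ m i p → m :* i :* p := m :* (p :* i)) refl (μ * ν) (1/[ n !]) ((x + y) ^ n) ⟩
    exp (μ * ν) (x + y) n ∎
    where
    term : ∀ {k} → k < suc n →
      exp μ x k * exp ν y (n ∸ k) ≈ μ * ν * 1/[ n !] * ((n C k) · (x ^ k * y ^ (n ∸ k)))
    term {k} (s≤s k≤n) = begin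
      μ * (x ^ k * 1/[ k !]) * (ν * (y ^ (n ∸ k) * 1/[ n ∸ k !]))
        ≈⟨ solve 6 (λ μ p i ν q j → μ :* (p :* i) :* (ν :* (q :* j)) := μ :* ν :* (con 1 :* (i :* j)) :* (p :* q)) refl _ _ _ _ _ _ ⟩
      μ * ν * (1# * (1/[ k !] * 1/[ n ∸ k !])) * (x ^ k * y ^ (n ∸ k))
        ≈⟨ *-congʳ (*-congˡ (*-congʳ (trans (*-comm _ _) (!*1/! n)))) ⟨
      μ * ν * (1/[ n !] * fromℕ (n !) * (1/[ k !] * 1/[ n ∸ k !])) * (x ^ k * y ^ (n ∸ k))
        ≈⟨ *-congʳ (*-congˡ (trans (*-assoc _ _ _) (*-congˡ (sym (fromℕ-C k≤n))))) ⟩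
      μ * ν * (1/[ n !] * fromℕ (n C k)) * (x ^ k * y ^ (n ∸ k))
        ≈⟨ solve 4 (λ m i c p → m :* (i :* c) :* p := m :* i :* (c :* p)) refl _ _ _ _ ⟩
      μ * ν * 1/[ n !] * (fromℕ (n C k) * (x ^ k * y ^ (n ∸ k)))
        ≈⟨ *-congˡ (trans (×-assoc-* (n C k) 1# _) (×-congʳ (n C k) (*-identityˡ _))) ⟩
      μ * ν * 1/[ n !] * ((n C k) · (x ^ k * y ^ (n ∸ k))) ∎

  x-y+y≈x : ∀ x y → x - y + y ≈ x
  x-y+y≈x x y = trans (+-assoc _ _ _) (trans (+-congˡ (-‿inverseˡ y)) (+-identityʳ x))

  1^n≈1 : ∀ n → 1# ^ n ≈ 1#
  1^n≈1 zero    = refl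
  1^n≈1 (suc n) = trans (*-identityˡ _) (1^n≈1 n)

  1/0!≈1 : 1/[ 0 !] ≈ 1#
  1/0!≈1 = inverse-unique (!*1/! 0) (trans (*-identityʳ _) (+-identityʳ 1#))

  exp-0 : exp 1# 0# ≋ one
  exp-0 zero    = trans (*-identityˡ _) (trans (*-identityˡ _) 1/0!≈1)
  exp-0 (suc n) = trans (*-identityˡ _) (trans (*-congʳ (zeroˡ _)) (zeroˡ _))

  exp-^ : ∀ μ n → exp μ 1# ^ₛ n ≋ exp (μ ^ n) (fromℕ n)
  exp-^ μ zero    = 𝕊.sym exp-0
  exp-^ μ (suc n) = 𝕊.trans (𝕊.*-congˡ {exp μ 1#} (exp-^ μ n)) (exp-⊛ μ (μ ^ n) 1# (fromℕ n))

  -- Substitution of xz for z.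
  scale : Carrier → Series → Series
  scale x f n = x ^ n * f n

  -- Substitution is multiplicative; the form with `h` carries the defining equations of the
  -- Bernoulli series from z to az and bz.
  scale-⊛ : ∀ x f g {h} → f ⊛ g ≋ h → scale x f ⊛ scale x g ≋ scale x h
  scale-⊛ x f g {h} eq n = begin
    (∑[0≤ k ≤ n ] (scale x f k * scale x g (n ∸ k)))    ≈⟨ sumBelow-cong (suc n) term ⟩
    (∑[0≤ k ≤ n ] (x ^ n * (f k * g (n ∸ k))))          ≈⟨ *-distribˡ-sum {suc n} (x ^ n) (λ k → f (toℕ k) * g (n ∸ toℕ k)) ⟨
    x ^ n * (f ⊛ g) n                                   ≈⟨ *-congˡ (eq n) ⟩
    x ^ n * h n                                         ∎
    where
    term : ∀ {k} → k < suc n → scale x f k * scale x g (n ∸ k) ≈ x ^ n * (f k * g (n ∸ k))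
    term {k} (s≤s k≤n) = begin
      x ^ k * f k * (x ^ (n ∸ k) * g (n ∸ k))      ≈⟨ solve 4 (λ p f q g → p :* f :* (q :* g) := p :* q :* (f :* g)) refl _ _ _ _ ⟩
      x ^ k * x ^ (n ∸ k) * (f k * g (n ∸ k))      ≈⟨ *-congʳ (^-homo-* x k (n ∸ k)) ⟨
      x ^ (k ℕ.+ (n ∸ k)) * (f k * g (n ∸ k))      ≡⟨ ≡.cong (λ t → x ^ t * (f k * g (n ∸ k))) (ℕₚ.m+[n∸m]≡n k≤n) ⟩
      x ^ n * (f k * g (n ∸ k))                    ∎

  scale-var : ∀ x → scale x var ≋ const x ⊛ var
  scale-var x n = trans (lemma n) (sym (const-⊛ x var n))
    where
    lemma : ∀ n → scale x var n ≈ x * var n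
    lemma zero          = trans (zeroʳ _) (sym (zeroʳ x))
    lemma (suc zero)    = *-congʳ (*-identityʳ x)
    lemma (suc (suc n)) = trans (zeroʳ _) (sym (zeroʳ x))

  scale-one : ∀ x → scale x one ≋ one
  scale-one x zero    = *-identityˡ 1#
  scale-one x (suc n) = zeroʳ _

  μeᶻ-1+1 : ∀ μ → μeᶻ-1 μ ⊕ one ≋ exp μ 1#
  μeᶻ-1+1 μ n = trans (x-y+y≈x _ _) (*-congˡ (sym (trans (*-congʳ (1^n≈1 n)) (*-identityˡ _))))

  scale-μeᶻ-1+1 : ∀ x μ → scale x (μeᶻ-1 μ) ⊕ one ≋ exp μ x
  scale-μeᶻ-1+1 x μ n = begin
    x ^ n * μeᶻ-1 μ n + one n             ≈⟨ +-congˡ (scale-one x n) ⟨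
    x ^ n * μeᶻ-1 μ n + x ^ n * one n     ≈⟨ distribˡ _ _ _ ⟨
    x ^ n * (μeᶻ-1 μ n + one n)           ≈⟨ *-congˡ (x-y+y≈x _ _) ⟩
    x ^ n * (μ * 1/[ n !])                ≈⟨ solve 3 (λ p m i → p :* (m :* i) := m :* (p :* i)) refl _ _ _ ⟩
    exp μ x n                             ∎

  sumBelow-coefficient : ∀ n (f : ℕ → Series) m → Σ𝕊.sumBelow n f m ≈ ∑[0≤ k < n ] f k m
  sumBelow-coefficient zero    f m = refl
  sumBelow-coefficient (suc n) f m = +-congˡ (sumBelow-coefficient n (f ∘ suc) m)

  -- The gap series at w = ƛ exp z

  module _ (a b : ℕ) .{{_ : NonZero a}} .{{_ : NonZero b}} (gcd≡1 : gcd a b ≡ 1)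
    {ƛ : Carrier} (ƛ⁻¹ : Carrier) (ƛ*ƛ⁻¹≈1 : ƛ * ƛ⁻¹ ≈ 1#) (ƛᵃ≈1 : ƛ ^ a ≈ 1#)
    (ƛᵇ#1 : ƛ ^ b # 1#) (ƛ#1 : ƛ # 1#)
    where

    gaps : Series
    gaps = Σ𝕊.gapSum a b gcd≡1 (exp ƛ 1#)

    -- Links the two instances of the indicator: as a series it is constant, and it acts on
    -- coefficients as the scalar one.
    gap-⊛ : ∀ n f m → (Σ𝕊.gap a b gcd≡1 n ⊛ f) m ≈ gap a b gcd≡1 n * f m
    gap-⊛ n f m with representable? a b n
    ... | yes rep = begin
      (Σ𝕊.gap a b gcd≡1 n ⊛ f) m      ≈⟨ 𝕊.*-congʳ {f} (Σ𝕊.gap-no a b gcd≡1 (λ ¬rep → ¬rep rep)) m ⟩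
      (0ₛ ⊛ f) m                      ≈⟨ ⊛-zeroˡ f m ⟩
      0#                              ≈⟨ zeroˡ (f m) ⟨
      0# * f m                        ≈⟨ *-congʳ (gap-no a b gcd≡1 (λ ¬rep → ¬rep rep)) ⟨
      gap a b gcd≡1 n * f m           ∎
    ... | no ¬rep = begin
      (Σ𝕊.gap a b gcd≡1 n ⊛ f) m      ≈⟨ 𝕊.*-congʳ {f} (Σ𝕊.gap-yes a b gcd≡1 ¬rep) m ⟩
      (one ⊛ f) m                     ≈⟨ ⊛-identityˡ f m ⟩
      f m                             ≈⟨ *-identityˡ (f m) ⟨
      1# * f m                        ≈⟨ *-congʳ (gap-yes a b gcd≡1 ¬rep) ⟨
      gap a b gcd≡1 n * f m           ∎

    gaps-coefficient : ∀ m → gaps m ≈ ∑[0≤ n < a ℕ.* b ] gap a b gcd≡1 n * exp (ƛ ^ n) (fromℕ n) m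
    gaps-coefficient m = trans
      (sumBelow-coefficient (a ℕ.* b) (λ n → Σ𝕊.gap a b gcd≡1 n ⊛ exp ƛ 1# ^ₛ n) m)
      (sumBelow-cong (a ℕ.* b) (λ {n} _ → trans (gap-⊛ n (exp ƛ 1# ^ₛ n) m) (*-congˡ (exp-^ ƛ n m))))

    -- The coefficient of z^m in ƛⁿ exp(nz) is ƛⁿ n^m / m!; the factor ƛ⁻¹ lowers the exponent of ƛ
    -- to n - 1.
    S≈gaps : ∀ m → S m ƛ a b ≈ ƛ⁻¹ * fromℕ (m !) * gaps m
    S≈gaps m = begin
      S m ƛ a b
        ≈⟨ sum-NR a b gcd≡1 (λ n → ƛ ^ (n ∸ 1) * fromℕ n ^ m) ⟩
      (∑[0≤ n < a ℕ.* b ] gap a b gcd≡1 n * (ƛ ^ (n ∸ 1) * fromℕ n ^ m))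
        ≈⟨ sumBelow-cong (a ℕ.* b) (λ {n} _ → term n) ⟩
      (∑[0≤ n < a ℕ.* b ] ƛ⁻¹ * fromℕ (m !) * (gap a b gcd≡1 n * exp (ƛ ^ n) (fromℕ n) m))
        ≈⟨ *-distribˡ-sum {a ℕ.* b} (ƛ⁻¹ * fromℕ (m !)) (λ n → gap a b gcd≡1 (toℕ n) * exp (ƛ ^ toℕ n) (fromℕ (toℕ n)) m) ⟨
      ƛ⁻¹ * fromℕ (m !) * (∑[0≤ n < a ℕ.* b ] gap a b gcd≡1 n * exp (ƛ ^ n) (fromℕ n) m)
        ≈⟨ *-congˡ (gaps-coefficient m) ⟨
      ƛ⁻¹ * fromℕ (m !) * gaps m ∎
      where
      term : ∀ n → gap a b gcd≡1 n * (ƛ ^ (n ∸ 1) * fromℕ n ^ m)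
                 ≈ ƛ⁻¹ * fromℕ (m !) * (gap a b gcd≡1 n * exp (ƛ ^ n) (fromℕ n) m)
      -- At n = 0 the truncated exponent `n ∸ 1` is not n - 1, but 0 is no gap and both sides
      -- vanish.
      term zero    = trans (*-congʳ gap-0≈0) (trans (zeroˡ _)
        (sym (trans (*-congˡ (trans (*-congʳ gap-0≈0) (zeroˡ _))) (zeroʳ _))))
        where
        gap-0≈0 : gap a b gcd≡1 0 ≈ 0#
        gap-0≈0 = gap-no a b gcd≡1 (λ ¬rep → ¬rep
          (≡.subst (Representable a b) (ℕₚ.*-zeroʳ b) (representable-multiple {a} {b} 0)))
      term (suc n) = sym (begin
        ƛ⁻¹ * fromℕ (m !) * (g * (ƛ * ƛ ^ n * (p * 1/[ m !])))
          ≈⟨ solve 7 (λ l f g ƛ x p i → l :* f :* (g :* (ƛ :* x :* (p :* i))) := ƛ :* l :* (f :* i) :* (g :* (x :* p))) refl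
               ƛ⁻¹ (fromℕ (m !)) g ƛ (ƛ ^ n) p (1/[ m !]) ⟩
        ƛ * ƛ⁻¹ * (fromℕ (m !) * 1/[ m !]) * (g * (ƛ ^ n * p))
          ≈⟨ *-congʳ (trans (*-cong ƛ*ƛ⁻¹≈1 (!*1/! m)) (*-identityˡ 1#)) ⟩
        1# * (g * (ƛ ^ n * p))
          ≈⟨ *-identityˡ _ ⟩
        g * (ƛ ^ n * p) ∎)
        where
        g p : Carrier
        g = gap a b gcd≡1 (suc n)
        p = fromℕ (suc n) ^ m

    -- β, γ and δ are the series of az / (exp(az) - 1), bz / (ƛᵇ exp(bz) - 1)
    -- and z / (ƛ exp z - 1), and κ is that of (exp(abz) - 1) / (abz).
    private
      α μ : Carrier
      α = fromℕ a
      μ = fromℕ b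

      β γ δ κ : Series
      β = scale α (egf B)
      γ = scale μ (egf (𝓑 (ƛ ^ b) ƛᵇ#1))
      δ = egf (𝓑 ƛ ƛ#1)
      κ k = (α * μ) ^ k * 1/[ suc k !]

      cancel : ∀ {f g} → const α ⊛ const μ ⊛ f ≋ const α ⊛ const μ ⊛ g → f ≋ g
      cancel {f} {g} eq n = fromℕ-cancel b (fromℕ-cancel a (trans (sym (αμ-⊛ f)) (trans (eq n) (αμ-⊛ g))))
        where
        αμ-⊛ : ∀ f → (const α ⊛ const μ ⊛ f) n ≈ α * (μ * f n)
        αμ-⊛ f = trans (⊛-assoc (const α) (const μ) f n)
          (trans (const-⊛ α (const μ ⊛ f) n) (*-congˡ (const-⊛ μ f n)))

      exp-a : scale α (μeᶻ-1 1#) ⊕ one ≋ exp ƛ 1# ^ₛ a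
      exp-a = 𝕊.trans (scale-μeᶻ-1+1 α 1#)
        (𝕊.trans (exp-cong (sym ƛᵃ≈1) refl) (𝕊.sym (exp-^ ƛ a)))

      exp-b : scale μ (μeᶻ-1 (ƛ ^ b)) ⊕ one ≋ exp ƛ 1# ^ₛ b
      exp-b = 𝕊.trans (scale-μeᶻ-1+1 μ (ƛ ^ b)) (𝕊.sym (exp-^ ƛ b))

      -- Since ƛ^(ab) = 1, the right side is exp(abz) with constant term 1; what remains after
      -- removing it is divisible by abz, with quotient κ.
      exp-ab : const α ⊛ const μ ⊛ (var ⊛ κ) ⊕ one ≋ (exp ƛ 1# ^ₛ b) ^ₛ a
      exp-ab = 𝕊.trans lemma (𝕊.trans (exp-cong (sym ƛᵇᵃ≈1) (trans (*-comm α μ) (sym (×1-homo-* b a))))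
        (𝕊.trans (𝕊.sym (exp-^ ƛ (b ℕ.* a))) (𝕊.sym (^ₛ-assocʳ (exp ƛ 1#) b a))))
        where
        ƛᵇᵃ≈1 : ƛ ^ (b ℕ.* a) ≈ 1#
        ƛᵇᵃ≈1 = trans (reflexive (≡.cong (ƛ ^_) (ℕₚ.*-comm b a))) (trans (sym (^-assocʳ ƛ a b)) (trans (^-congˡ b ƛᵃ≈1) (1^n≈1 b)))
        αμ-⊛ : ∀ n → (const α ⊛ const μ ⊛ (var ⊛ κ)) n ≈ α * μ * (var ⊛ κ) n
        αμ-⊛ n = trans (⊛-assoc (const α) (const μ) (var ⊛ κ) n)
          (trans (const-⊛ α (const μ ⊛ (var ⊛ κ)) n) (trans (*-congˡ (const-⊛ μ (var ⊛ κ) n)) (sym (*-assoc _ _ _))))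
        lemma : const α ⊛ const μ ⊛ (var ⊛ κ) ⊕ one ≋ exp 1# (α * μ)
        lemma zero    = begin
          (const α ⊛ const μ ⊛ (var ⊛ κ)) 0 + 1#    ≈⟨ +-congʳ (trans (αμ-⊛ 0) (trans (*-congˡ (trans (+-identityʳ _) (zeroˡ _))) (zeroʳ _))) ⟩
          0# + 1#                                   ≈⟨ +-identityˡ 1# ⟩
          1#                                        ≈⟨ trans (*-identityˡ _) (trans (*-identityˡ _) 1/0!≈1) ⟨
          1# * (1# * 1/[ 0 !])                      ∎
        lemma (suc n) = begin
          (const α ⊛ const μ ⊛ (var ⊛ κ)) (suc n) + 0#      ≈⟨ +-identityʳ _ ⟩
          (const α ⊛ const μ ⊛ (var ⊛ κ)) (suc n)           ≈⟨ trans (αμ-⊛ (suc n)) (*-congˡ (var-⊛ κ n)) ⟩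
          α * μ * ((α * μ) ^ n * 1/[ suc n !])              ≈⟨ *-assoc _ _ _ ⟨
          (α * μ) ^ suc n * 1/[ suc n !]                    ≈⟨ *-identityˡ _ ⟨
          exp 1# (α * μ) (suc n)                            ∎

    gaps-series : var ⊛ gaps ⊕ δ ≋ β ⊛ γ ⊛ κ
    gaps-series = var-⊛-cancel (var-⊛-cancel (cancel
      (Σ𝕊.gapSum-cleared a b gcd≡1 {Q = const α ⊛ const μ ⊛ (var ⊛ κ)} {z = var} {β} {γ} {δ} {κ} {const α} {const μ}
        (μeᶻ-1+1 ƛ) exp-a exp-b exp-ab
        (𝓑-spec ƛ ƛ#1)
        (𝕊.trans (scale-⊛ α (μeᶻ-1 1#) (egf B) B-spec) (scale-var α))
        (𝕊.trans (scale-⊛ μ (μeᶻ-1 (ƛ ^ b)) (egf (𝓑 (ƛ ^ b) ƛᵇ#1)) (𝓑-spec (ƛ ^ b) ƛᵇ#1)) (scale-var μ))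
        (𝕊.refl {const α ⊛ const μ ⊛ (var ⊛ κ)}))))

    -- Comparison of coefficients

    private
      -- The origin of both denominators: m! = (m+1)! / (m+1), and the shifted factorial of κ
      -- contributes 1 / (m-ℓ+2) besides 1 / (m+1-ℓ)!. The two binomials share ℓ!, which cancels.
      factorials : ∀ m {ℓ i} → ℓ ≤ suc m → i ≤ ℓ →
        fromℕ (m !) * (1/[ i !] * 1/[ ℓ ∸ i !] * 1/[ suc (suc m ∸ ℓ) !])
          ≈ fromℕ (suc m C ℓ) * fromℕ (ℓ C i) * 1/ℕ (suc (suc m ∸ ℓ) ℕ.* suc m)
      factorials m {ℓ} {i} ℓ≤1+m i≤ℓ = sym (begin
        fromℕ (suc m C ℓ) * fromℕ (ℓ C i) * 1/ℕ (suc k ℕ.* suc m)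
          ≈⟨ *-cong (*-cong (fromℕ-C ℓ≤1+m) (fromℕ-C i≤ℓ)) (1/ℕ-* (suc k) (suc m)) ⟩
        fromℕ (suc m !) * (1/[ ℓ !] * 1/[ k !]) * (fromℕ (ℓ !) * (1/[ i !] * 1/[ ℓ ∸ i !])) * (1/ℕ (suc k) * 1/ℕ (suc m))
          ≈⟨ *-congʳ (*-congʳ (*-congʳ (×1-homo-* (suc m) (m !)))) ⟩
        fromℕ (suc m) * fromℕ (m !) * (1/[ ℓ !] * 1/[ k !]) * (fromℕ (ℓ !) * (1/[ i !] * 1/[ ℓ ∸ i !])) * (1/ℕ (suc k) * 1/ℕ (suc m))
          ≈⟨ solve 9 (λ sm fm il ik fl ii ij rk rm → sm :* fm :* (il :* ik) :* (fl :* (ii :* ij)) :* (rk :* rm)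
                        := sm :* rm :* (fl :* il) :* (fm :* (ii :* ij :* (rk :* ik)))) refl _ _ _ _ _ _ _ _ _ ⟩
        fromℕ (suc m) * 1/ℕ (suc m) * (fromℕ (ℓ !) * 1/[ ℓ !]) * (fromℕ (m !) * (1/[ i !] * 1/[ ℓ ∸ i !] * (1/ℕ (suc k) * 1/[ k !])))
          ≈⟨ *-congʳ (trans (*-cong (fromℕ*1/ℕ (suc m)) (!*1/! ℓ)) (*-identityˡ 1#)) ⟩
        1# * (fromℕ (m !) * (1/[ i !] * 1/[ ℓ ∸ i !] * (1/ℕ (suc k) * 1/[ k !])))
          ≈⟨ *-identityˡ _ ⟩
        fromℕ (m !) * (1/[ i !] * 1/[ ℓ ∸ i !] * (1/ℕ (suc k) * 1/[ k !]))
          ≈⟨ *-congˡ (*-congˡ (1/[1+n]! k)) ⟨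
        fromℕ (m !) * (1/[ i !] * 1/[ ℓ ∸ i !] * 1/[ suc k !]) ∎)
        where
        k : ℕ
        k = suc m ∸ ℓ

    -- The grouping `suc m ∸ ℓ` keeps truncated subtraction exact up to ℓ = m + 1, where m - ℓ is
    -- negative.
    summand : (m ℓ i : ℕ) → Carrier
    summand m ℓ i = fromℕ (suc m C ℓ) * fromℕ (ℓ C i)
      * (fromℕ a ^ ((suc m ∸ ℓ) ℕ.+ i) * fromℕ b ^ (suc m ∸ i)
          * 1/ℕ (suc (suc m ∸ ℓ) ℕ.* suc m) * ƛ⁻¹)
      * B i * 𝓑 (ƛ ^ b) ƛᵇ#1 (ℓ ∸ i)

    private
      summand-product : ∀ m {ℓ i} → ℓ ≤ suc m → i ≤ ℓ →
        ƛ⁻¹ * fromℕ (m !) * (β i * γ (ℓ ∸ i) * κ (suc m ∸ ℓ)) ≈ summand m ℓ i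
      summand-product m {ℓ} {i} ℓ≤1+m i≤ℓ = begin
        ƛ⁻¹ * fromℕ (m !) * (α ^ i * (B i * 1/[ i !]) * (μ ^ j * (𝓑ⱼ * 1/[ j !])) * ((α * μ) ^ k * 1/[ suc k !]))
          ≈⟨ *-congˡ (*-congˡ (*-congʳ (^-distrib-* α μ k))) ⟩
        ƛ⁻¹ * fromℕ (m !) * (α ^ i * (B i * 1/[ i !]) * (μ ^ j * (𝓑ⱼ * 1/[ j !])) * (α ^ k * μ ^ k * 1/[ suc k !]))
          ≈⟨ solve 11 (λ l f αi Bi ii μj Bj ij αk μk ik →
               l :* f :* (αi :* (Bi :* ii) :* (μj :* (Bj :* ij)) :* (αk :* μk :* ik))
                 := f :* (ii :* ij :* ik) :* (αk :* αi :* (μk :* μj) :* l) :* Bi :* Bj) refl _ _ _ _ _ _ _ _ _ _ _ ⟩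
        fromℕ (m !) * (1/[ i !] * 1/[ j !] * 1/[ suc k !]) * (α ^ k * α ^ i * (μ ^ k * μ ^ j) * ƛ⁻¹) * B i * 𝓑ⱼ
          ≈⟨ *-congʳ (*-congʳ (*-cong (factorials m ℓ≤1+m i≤ℓ) (*-congʳ (*-cong (sym (^-homo-* α k i)) (sym (^-homo-* μ k j)))))) ⟩
        c₁ * c₂ * r * (α ^ (k ℕ.+ i) * μ ^ (k ℕ.+ j) * ƛ⁻¹) * B i * 𝓑ⱼ
          -- γ supplies ℓ - i powers of b and κ supplies m + 1 - ℓ.
          ≡⟨ ≡.cong (λ t → c₁ * c₂ * r * (α ^ (k ℕ.+ i) * μ ^ t * ƛ⁻¹) * B i * 𝓑ⱼ) k+j≡1+m∸i ⟩
        c₁ * c₂ * r * (α ^ (k ℕ.+ i) * μ ^ (suc m ∸ i) * ƛ⁻¹) * B i * 𝓑ⱼ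
          ≈⟨ *-congʳ (*-congʳ (solve 5 (λ c r p q l → c :* r :* (p :* q :* l) := c :* (p :* q :* r :* l)) refl _ _ _ _ _)) ⟩
        c₁ * c₂ * (α ^ (k ℕ.+ i) * μ ^ (suc m ∸ i) * r * ƛ⁻¹) * B i * 𝓑ⱼ ∎
        where
        k j : ℕ
        k = suc m ∸ ℓ
        j = ℓ ∸ i
        𝓑ⱼ c₁ c₂ r : Carrier
        𝓑ⱼ = 𝓑 (ƛ ^ b) ƛᵇ#1 j
        c₁ = fromℕ (suc m C ℓ)
        c₂ = fromℕ (ℓ C i)
        r = 1/ℕ (suc k ℕ.* suc m)
        k+j≡1+m∸i : k ℕ.+ j ≡ suc m ∸ i
        k+j≡1+m∸i = ≡.trans (≡.sym (ℕₚ.+-∸-assoc k i≤ℓ)) (≡.cong (_∸ i) (ℕₚ.m∸n+n≡m ℓ≤1+m))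

      -- The double sum is the coefficient of a triple product: i is the degree taken from β, ℓ the
      -- degree taken from β γ.
      sum-summand : ∀ m → ƛ⁻¹ * fromℕ (m !) * (β ⊛ γ ⊛ κ) (suc m)
        ≈ (∑[0≤ ℓ ≤ suc m ] ∑[0≤ i ≤ ℓ ] (summand m ℓ i))
      sum-summand m = trans
        (*-distribˡ-sum {suc (suc m)} s (λ ℓ → (β ⊛ γ) (toℕ ℓ) * κ (suc m ∸ toℕ ℓ)))
        (sumBelow-cong (suc (suc m)) (λ { {ℓ} (s≤s ℓ≤1+m) → begin
          s * ((β ⊛ γ) ℓ * κ (suc m ∸ ℓ))
            ≈⟨ *-congˡ (*-distribʳ-sum {suc ℓ} (κ (suc m ∸ ℓ)) (λ i → β (toℕ i) * γ (ℓ ∸ toℕ i))) ⟩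
          s * (∑[0≤ i ≤ ℓ ] (β i * γ (ℓ ∸ i) * κ (suc m ∸ ℓ)))
            ≈⟨ *-distribˡ-sum {suc ℓ} s (λ i → β (toℕ i) * γ (ℓ ∸ toℕ i) * κ (suc m ∸ ℓ)) ⟩
          (∑[0≤ i ≤ ℓ ] (s * (β i * γ (ℓ ∸ i) * κ (suc m ∸ ℓ))))
            ≈⟨ sumBelow-cong (suc ℓ) (λ { (s≤s i≤ℓ) → summand-product m ℓ≤1+m i≤ℓ }) ⟩
          (∑[0≤ i ≤ ℓ ] (summand m ℓ i)) ∎ }))
        where
        s : Carrier
        s = ƛ⁻¹ * fromℕ (m !)

      δ-coefficient : ∀ m → ƛ⁻¹ * fromℕ (m !) * δ (suc m) ≈ 𝓑 ƛ ƛ#1 (suc m) * (1/ℕ (suc m) * ƛ⁻¹)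
      δ-coefficient m = begin
        ƛ⁻¹ * fromℕ (m !) * (x * 1/[ suc m !])
          ≈⟨ *-congˡ (*-congˡ (1/[1+n]! m)) ⟩
        ƛ⁻¹ * fromℕ (m !) * (x * (1/ℕ (suc m) * 1/[ m !]))
          ≈⟨ solve 5 (λ l f x r i → l :* f :* (x :* (r :* i)) := f :* i :* (x :* (r :* l))) refl _ _ _ _ _ ⟩
        fromℕ (m !) * 1/[ m !] * (x * (1/ℕ (suc m) * ƛ⁻¹))
          ≈⟨ trans (*-congʳ (!*1/! m)) (*-identityˡ _) ⟩
        x * (1/ℕ (suc m) * ƛ⁻¹) ∎
        where
        x : Carrier
        x = 𝓑 ƛ ƛ#1 (suc m)

    S-formula : ∀ m → S m ƛ a b
      ≈ (∑[0≤ ℓ ≤ suc m ] ∑[0≤ i ≤ ℓ ] (summand m ℓ i)) - 𝓑 ƛ ƛ#1 (suc m) * (1/ℕ (suc m) * ƛ⁻¹)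
    S-formula m = begin
      S m ƛ a b              ≈⟨ +-identityʳ _ ⟨
      S m ƛ a b + 0#         ≈⟨ +-congˡ (-‿inverseʳ y) ⟨
      S m ƛ a b + (y - y)    ≈⟨ +-assoc _ _ _ ⟨
      S m ƛ a b + y - y      ≈⟨ +-congʳ S+y ⟩
      (∑[0≤ ℓ ≤ suc m ] ∑[0≤ i ≤ ℓ ] (summand m ℓ i)) - y ∎
      where
      y s : Carrier
      y = 𝓑 ƛ ƛ#1 (suc m) * (1/ℕ (suc m) * ƛ⁻¹)
      s = ƛ⁻¹ * fromℕ (m !)
      S+y : S m ƛ a b + y ≈ (∑[0≤ ℓ ≤ suc m ] ∑[0≤ i ≤ ℓ ] (summand m ℓ i))
      S+y = begin
        S m ƛ a b + y                                  ≈⟨ +-cong (S≈gaps m) (sym (δ-coefficient m)) ⟩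
        s * gaps m + s * δ (suc m)                     ≈⟨ distribˡ s _ _ ⟨
        -- The extra factor z in `gaps-series` is why m becomes m + 1 throughout the formula.
        s * (gaps m + δ (suc m))                       ≈⟨ *-congˡ (+-congʳ (var-⊛ gaps m)) ⟨
        s * ((var ⊛ gaps) (suc m) + δ (suc m))         ≈⟨ *-congˡ (gaps-series (suc m)) ⟩
        s * (β ⊛ γ ⊛ κ) (suc m)                        ≈⟨ sum-summand m ⟩
        (∑[0≤ ℓ ≤ suc m ] ∑[0≤ i ≤ ℓ ] (summand m ℓ i)) ∎

-- Specialisation to the complex numbers

open import Defs

theorem3 :
  (a b : ℕ) .{{_ : NonZero a}} .{{_ : NonZero b}} → gcd a b ≡ 1 →
  (ƛ : ℂ) → ¬ (ƛ ≈ 0#) → (ƛᵃ≈1 : ƛ ^ a ≈ 1#) → (ƛᵇ≉1 : ¬ (ƛ ^ b ≈ 1#)) →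
  (m : ℕ) →
  let ƛ⁻¹  = inverse ƛ (root#0 a ƛᵃ≈1)
      ƛᵇ#1 = root^≉1⇒#1 a b ƛᵃ≈1 ƛᵇ≉1
      ƛ#1  = #1-root b ƛᵇ#1
  in
  S m ƛ a b
    ≈ (∑[0≤ ℓ ≤ suc m ] ∑[0≤ i ≤ ℓ ]
        (fromℕ (suc m C ℓ) * fromℕ (ℓ C i)
          * (fromℕ a ^ ((suc m ∸ ℓ) ℕ.+ i) * fromℕ b ^ (suc m ∸ i)
              * 1/ℕ (suc (suc m ∸ ℓ) ℕ.* suc m) * ƛ⁻¹)
          * B i * 𝓑 (ƛ ^ b) ƛᵇ#1 (ℓ ∸ i)))
      - 𝓑 ƛ ƛ#1 (suc m) * (1/ℕ (suc m) * ƛ⁻¹)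
theorem3 a b gcd≡1 ƛ _ ƛᵃ≈1 ƛᵇ≉1 m =
  S-formula a b gcd≡1 (inverse ƛ ƛ#0) (inverseʳ ƛ ƛ#0) ƛᵃ≈1 ƛᵇ#1 (#1-root b ƛᵇ#1) m
  where
  open GapSums ℂ-heytingField ℂ-characteristic0 using (S-formula)
  open FieldProperties ℂ-heytingField using (inverseʳ)
  ƛ#0 : ƛ # 0#
  ƛ#0 = root#0 a ƛᵃ≈1
  -- `𝓑` requires apartness from 1, constructively stronger than inequality; it is available because
  -- ƛᵇ is an a-th root of unity, and 1 is a simple root of xᵃ - 1.
  ƛᵇ#1 : ƛ ^ b # 1#
  ƛᵇ#1 = root^≉1⇒#1 a b ƛᵃ≈1 ƛᵇ≉1
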